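{- Let $\ell\ge 2$ be an integer, let $G$ be a graph in $\mathcal{G}_{\ell}$, and let $S\subset V(G)$ be a set of vertices with $G[S]$ connected. Then: (i) for every edge $e$ of $G$ that is not contained in any cycle of length $2\ell+1$, the graph $G-e$ belongs to $\mathcal{G}_{\ell}$; (ii) if $G[L_i(S)]$ is bipartite for each $i\in\{1,\ldots,\lfloor \ell/2\rfloor\}$, then $G[L_i(S)]$ is bipartite for every integer $i>0$; (iii) $\chi(G)\le 4$.
   Context: All graphs are finite and simple. A hole is an induced cycle of length at least $4$; an odd hole is a hole of odd length. The girth of a graph is the length of a shortest cycle. For an integer $\ell\ge 2$, $\mathcal{G}_{\ell}$ denotes the family of graphs that have girth exactly $2\ell+1$ and have no odd holes of length at least $2\ell+3$. For a vertex $x$ and a nonempty set $S\subseteq V(G)$, $d(x,S)=\min\{d(x,y):y\in S\}$ (graph distance), and $L_i(S)=\{x\in V(G): d(x,S)=i\}$ for each integer $i\ge 0$. $G[X]$ denotes the subgraph induced by $X$, and $\chi(G)$ is the chromatic number. -}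

module Defs where

open import Data.Nat using (ℕ; zero; suc; _+_; _*_; _≤_; _<_; _%_; _/_)
open import Data.Fin using (Fin; toℕ; fromℕ; inject₁; _≟_) renaming (zero to fzero; suc to fsuc)
open import Data.Fin.Subset using (Subset; _∈_)
open import Data.Bool using (Bool; true; false; _∧_; _∨_; not)
open import Data.Bool.Properties using (∨-comm)
open import Data.Product using (Σ; ∃; ∃-syntax; _×_; _,_)
open import Data.Sum using (_⊎_)
open import Relation.Nullary using (¬_; ⌊_⌋)
open import Relation.Binary.PropositionalEquality using (_≡_; _≢_; refl; cong; cong₂; trans; sym)
open import Function.Definitions using (Injective)

record Graph (n : ℕ) : Set where
  field
    adj       : Fin n → Fin n → Bool
    adj-sym   : ∀ x y → adj x y ≡ adj y x
    adj-irrefl : ∀ x → adj x x ≡ false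
open Graph public

Adj : ∀ {n} → Graph n → Fin n → Fin n → Set
Adj G x y = adj G x y ≡ true

Consec : (k : ℕ) → Fin k → Fin k → Set
Consec k i j = (suc (toℕ i) ≡ toℕ j) ⊎ ((suc (toℕ i) ≡ k) × (toℕ j ≡ 0))

IsCycle : ∀ {n} → Graph n → (k : ℕ) → (Fin k → Fin n) → Set
IsCycle G k c = (3 ≤ k) × Injective _≡_ _≡_ c × (∀ i j → Consec k i j → Adj G (c i) (c j))

IsInducedCycle : ∀ {n} → Graph n → (k : ℕ) → (Fin k → Fin n) → Set
IsInducedCycle G k c =
  IsCycle G k c × (∀ i j → Adj G (c i) (c j) → Consec k i j ⊎ Consec k j i)

IsHole : ∀ {n} → Graph n → (k : ℕ) → (Fin k → Fin n) → Set
IsHole G k c = IsInducedCycle G k c × (4 ≤ k)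

Odd : ℕ → Set
Odd k = k % 2 ≡ 1

IsOddHole : ∀ {n} → Graph n → (k : ℕ) → (Fin k → Fin n) → Set
IsOddHole G k c = IsHole G k c × Odd k

HasCycleOfLength : ∀ {n} → Graph n → ℕ → Set
HasCycleOfLength G k = Σ (Fin k → _) λ c → IsCycle G k c

GirthEq : ∀ {n} → Graph n → ℕ → Set
GirthEq G g = HasCycleOfLength G g × (∀ k → k < g → ¬ HasCycleOfLength G k)

In𝒢 : ℕ → ∀ {n} → Graph n → Set
In𝒢 ℓ G = GirthEq G (2 * ℓ + 1)
        × (∀ k (c : Fin k → _) → 2 * ℓ + 3 ≤ k → ¬ IsOddHole G k c)

SamePair : ∀ {n} → Fin n → Fin n → Fin n → Fin n → Set
SamePair x y u v = (x ≡ u × y ≡ v) ⊎ (x ≡ v × y ≡ u)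

EdgeOnCycleOfLength : ∀ {n} → Graph n → ℕ → Fin n → Fin n → Set
EdgeOnCycleOfLength G k u v =
  Σ (Fin k → _) λ c → IsCycle G k c × ∃ λ i → ∃ λ j → Consec k i j × SamePair (c i) (c j) u v

private
  isPair : ∀ {n} → Fin n → Fin n → Fin n → Fin n → Bool
  isPair u v x y = (⌊ x ≟ u ⌋ ∧ ⌊ y ≟ v ⌋) ∨ (⌊ x ≟ v ⌋ ∧ ⌊ y ≟ u ⌋)

  isPair-sym : ∀ {n} (u v x y : Fin n) → isPair u v x y ≡ isPair u v y x
  isPair-sym u v x y with ⌊ x ≟ u ⌋ | ⌊ y ≟ v ⌋ | ⌊ x ≟ v ⌋ | ⌊ y ≟ u ⌋
  ... | a | b | c | d = trans (∨-comm (a ∧ b) (c ∧ d))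
                              (cong₂ _∨_ (∧-c c d) (∧-c a b))
    where
      ∧-c : ∀ p q → p ∧ q ≡ q ∧ p
      ∧-c false false = refl
      ∧-c false true = refl
      ∧-c true false = refl
      ∧-c true true = refl

  ∧-false : ∀ b → false ∧ b ≡ false
  ∧-false b = refl

deleteEdge : ∀ {n} → Graph n → Fin n → Fin n → Graph n
deleteEdge G u v = record
  { adj = λ x y → adj G x y ∧ not (isPair u v x y)
  ; adj-sym = λ x y → cong₂ _∧_ (adj-sym G x y) (cong not (isPair-sym u v x y))
  ; adj-irrefl = λ x → trans (cong (λ b → b ∧ not (isPair u v x x)) (adj-irrefl G x)) refl
  }

Walk : ∀ {n} → Graph n → ℕ → Fin n → Fin n → Set
Walk {n} G k x y =
  Σ (Fin (suc k) → Fin n) λ w →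
    (w fzero ≡ x) × (w (fromℕ k) ≡ y) × (∀ (i : Fin k) → Adj G (w (inject₁ i)) (w (fsuc i)))

DistToSet : ∀ {n} → Graph n → Subset n → Fin n → ℕ → Set
DistToSet G S x i =
  (∃ λ y → y ∈ S × Walk G i x y)
  × (∀ j → j < i → ∀ y → y ∈ S → ¬ Walk G j x y)

Level : ∀ {n} → Graph n → Subset n → ℕ → Fin n → Set
Level G S i x = DistToSet G S x i

InducedConnected : ∀ {n} → Graph n → Subset n → Set
InducedConnected {n} G S =
  (∃ λ s → s ∈ S)
  × (∀ x y → x ∈ S → y ∈ S →
       ∃ λ k → Σ (Walk G k x y) λ w → ∀ i → Data.Product.proj₁ w i ∈ S)

InducedBipartite : ∀ {n} → Graph n → (Fin n → Set) → Set
InducedBipartite {n} G X =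
  Σ (Fin n → Bool) λ f → ∀ x y → X x → X y → Adj G x y → f x ≢ f y

ChromaticAtMost : ∀ {n} → Graph n → ℕ → Set
ChromaticAtMost {n} G k =
  Σ (Fin n → Fin k) λ f → ∀ x y → Adj G x y → f x ≢ f y

{-# OPTIONS --safe #-}
module Submission where

-- (i) If an odd hole of G − e is not a hole of G, then e is its only chord and splits it into two induced
-- cycles of G, one of them odd; that one has length 2ℓ + 1 and contains e.
--
-- (ii) If level i of S is not bipartite, it contains an induced odd cycle, which has the form c₀ … c_{2ℓ}.
-- Let u_s be a neighbour of c_s in level i − 1. A path from u_s to u_{s+d} (2 ≤ d ≤ ℓ) that is induced and
-- runs below level i − 1 closes up with both arcs between c_s and c_{s+d}; one of the two resulting induced cycles
-- is odd, so the path has length 2ℓ − 1 − d. For ℓ = 2 this makes the u_s a 5-cycle in level i − 1. For ℓ = 3 it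
-- produces a closed walk that contains a cycle of length at most 6. For ℓ ≥ 4 and i ≥ 3 there are such
-- paths from u₀ to u_ℓ and to u_{ℓ+1} with the same first edge; cutting it off leaves a walk of length
-- 2ℓ − 4 from u_ℓ to u_{ℓ+1}, which c_ℓ c_{ℓ+1} completes to a closed walk too short for the girth.
--
-- (iii) For S = {r} the levels 1, …, ⌊ℓ/2⌋ are stable by the girth, so all levels are bipartite; use two
-- colours on the even levels and two others on the odd ones, in each component.

open import Defs
open import Data.Bool using (Bool; true; false; _xor_; not; _∧_; _∨_)
import Data.Bool.Properties as Bool
open import Data.Unit using (⊤; tt)
open import Data.Empty using (⊥; ⊥-elim)
open import Data.Fin using (Fin; toℕ; fromℕ; fromℕ<; inject₁; _≟_) renaming (zero to fzero; suc to fsuc)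
import Data.Fin.Properties as Fin
open import Data.Fin.Subset using (Subset; _∈_; ⁅_⁆)
open import Data.Fin.Subset.Properties using (_∈?_; x∈⁅x⁆; x∈⁅y⁆⇒x≡y)
open import Data.List using (List; []; _∷_; allFin; cartesianProduct)
open import Data.List.Membership.Propositional.Properties using (∈-allFin; ∈-cartesianProduct⁺)
open import Data.List.Relation.Unary.All as All using (All)
open import Data.Nat using (ℕ; zero; suc; _+_; _*_; _∸_; _≤_; _<_; _/_; _%_; z≤n; s≤s; _≤?_)
import Data.Nat.Properties as ℕ
open import Data.Nat.DivMod using ([m+kn]%n≡m%n; m*n%n≡0; m%n<n; m≡m%n+[m/n]*n; /-monoˡ-≤; [m+n]%n≡m%n; %-distribˡ-+; m<n⇒m%n≡m; n%n≡0; m/n*n≤m)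
open import Data.Nat.Induction using (<-rec)
open import Data.Nat.Tactic.RingSolver using (solve)
open import Data.Product using (∃; _×_; _,_; proj₁; proj₂)
open import Data.Sum using (_⊎_; inj₁; inj₂; [_,_]′) renaming (map to map-⊎)
open import Function using (_∘_)
open import Relation.Binary.PropositionalEquality using (_≡_; _≢_; refl; sym; trans; cong; cong₂; subst; subst₂)
open import Relation.Nullary using (¬_; Dec; yes; no; ⌊_⌋)
open import Relation.Nullary.Decidable using (_×-dec_; _⊎-dec_; map′; ¬?)
open import Relation.Binary.Definitions using (tri<; tri≈; tri>)

-- The hypothesis p ≤ q gives x ≤ y as soon as y − x = (q − p) + r; the equation is this one with the
-- subtractions moved over. A contradictory system of inequalities is refuted by deriving 1 ≤ 0 from it.
linear : ∀ r {x y p q} → p ≤ q → y + p ≡ x + q + r → x ≤ y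
linear r {x} {y} {p} {q} p≤q eq =
  ℕ.+-cancelʳ-≤ q x y
    (ℕ.≤-trans (ℕ.≤-trans (ℕ.m≤m+n (x + q) r) (ℕ.≤-reflexive (sym eq))) (ℕ.+-monoʳ-≤ y p≤q))

≤⇒∃+ : ∀ {m n} → m ≤ n → ∃ λ r → n ≡ m + r
≤⇒∃+ {m} {n} m≤n = n ∸ m , sym (ℕ.m+[n∸m]≡n m≤n)

<⇒∃+ : ∀ {m n} → m < n → ∃ λ r → n ≡ m + suc r
<⇒∃+ {m} m<n with ≤⇒∃+ m<n
... | r , eq = r , trans eq (sym (ℕ.+-suc m r))

-- The drop in length when a closed stretch of `suc e` steps is cut out of a walk. `chord<` is the
-- drop when a single chord replaces `suc (suc e)` steps.
skip< : ∀ s e r → s + r < s + suc e + r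
skip< s e r = linear e (ℕ.≤-refl {0}) (solve (s ∷ e ∷ r ∷ []))

chord< : ∀ s e r → s + suc r < s + suc (suc e) + r
chord< s e r = linear e (ℕ.≤-refl {0}) (solve (s ∷ e ∷ r ∷ []))

least : {P : ℕ → Set} → (∀ k → Dec (P k)) → ∀ m → P m →
        ∃ λ k → k ≤ m × P k × (∀ j → j < k → ¬ P j)
least {P} P? = <-rec _ step
  where
  step : ∀ m → (∀ {j} → j < m → P j → ∃ λ k → k ≤ j × P k × (∀ i → i < k → ¬ P i)) →
         P m → ∃ λ k → k ≤ m × P k × (∀ i → i < k → ¬ P i)
  step m rec pm with ℕ.anyUpTo? P? m
  ... | no none = m , ℕ.≤-refl , pm , λ j j<m pj → none (j , j<m , pj)
  ... | yes (j , j<m , pj) with rec j<m pj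
  ...   | k , k≤j , pk , min = k , ℕ.≤-trans k≤j (ℕ.<⇒≤ j<m) , pk , min

-- Parity of natural numbers

Even : ℕ → Set
Even k = ∃ λ j → k ≡ j * 2

even⊎odd : ∀ k → Even k ⊎ ∃ λ j → k ≡ 1 + j * 2
even⊎odd zero = inj₁ (0 , refl)
even⊎odd (suc k) with even⊎odd k
... | inj₁ (j , refl) = inj₂ (j , refl)
... | inj₂ (j , refl) = inj₁ (suc j , refl)

1+2j-odd : ∀ j → Odd (1 + j * 2)
1+2j-odd j = [m+kn]%n≡m%n 1 j 2

odd⇒ : ∀ k → Odd k → ∃ λ j → k ≡ 1 + j * 2
odd⇒ k o with even⊎odd k
... | inj₂ p = p
... | inj₁ (j , refl) with trans (sym (m*n%n≡0 j 2)) o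
...   | ()

odd-+ : ∀ a b → Odd (a + b) → Odd a ⊎ Odd b
odd-+ a b o with even⊎odd a | even⊎odd b
... | inj₂ (j , refl) | _ = inj₁ (1+2j-odd j)
... | _ | inj₂ (j , refl) = inj₂ (1+2j-odd j)
... | inj₁ (i , refl) | inj₁ (j , refl)
  with trans (sym (m*n%n≡0 (i + j) 2)) (trans (cong (_% 2) (ℕ.*-distribʳ-+ 2 i j)) o)
...   | ()

-- Walks and geodesics

infixr 5 _◃_

-- The relation is a parameter so that the same operations serve all of `G`, an induced subgraph
-- (`Within`) and the graph without one edge (`OtherEdge`).
data Wk {V : Set} (R : V → V → Set) : ℕ → V → V → Set where
  nil : ∀ {x} → Wk R 0 x x
  _◃_ : ∀ {k x y z} → R x y → Wk R k y z → Wk R (suc k) x z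

module _ {V : Set} {R : V → V → Set} where

  infixr 5 _++_

  _++_ : ∀ {k l x y z} → Wk R k x y → Wk R l y z → Wk R (k + l) x z
  nil     ++ v = v
  (r ◃ w) ++ v = r ◃ (w ++ v)

  snoc : ∀ {k x y z} → Wk R k x y → R y z → Wk R (suc k) x z
  snoc nil     r = r ◃ nil
  snoc (s ◃ w) r = s ◃ snoc w r

  reverse : (∀ {x y} → R x y → R y x) → ∀ {k x y} → Wk R k x y → Wk R k y x
  reverse R-sym nil     = nil
  reverse R-sym (r ◃ w) = snoc (reverse R-sym w) (R-sym r)

  mapWk : ∀ {Q : V → V → Set} → (∀ {x y} → R x y → Q x y) → ∀ {k x y} → Wk R k x y → Wk Q k x y
  mapWk f nil     = nil
  mapWk f (r ◃ w) = f r ◃ mapWk f w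

  at : ∀ {k x y} → Wk R k x y → ℕ → V
  at {x = x} w       zero    = x
  -- Past its end a walk is taken to rest at its last vertex.
  at {x = x} nil     (suc s) = x
  at         (r ◃ w) (suc s) = at w s

  at-end : ∀ {k x y} (w : Wk R k x y) → at w k ≡ y
  at-end nil     = refl
  at-end (r ◃ w) = at-end w

  at-step : ∀ {k x y} (w : Wk R k x y) → ∀ s → s < k → R (at w s) (at w (suc s))
  at-step (r ◃ nil)   zero    _         = r
  at-step (r ◃ s ◃ w) zero    _         = r
  at-step (r ◃ w)     (suc s) (s≤s s<k) = at-step w s s<k

  segment : ∀ (g : ℕ → V) s d → (∀ i → s ≤ i → i < s + d → R (g i) (g (suc i))) → Wk R d (g s) (g (s + d))
  segment g s zero    step = subst (λ t → Wk R 0 (g s) (g t)) (sym (ℕ.+-identityʳ s)) nil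
  segment g s (suc d) step =
    step s ℕ.≤-refl (ℕ.m<m+n s (s≤s z≤n)) ◃
    subst (λ t → Wk R d (g (suc s)) (g t)) (sym (ℕ.+-suc s d))
      (segment g (suc s) d λ i s<i i< → step i (ℕ.<⇒≤ s<i) (subst (i <_) (sym (ℕ.+-suc s d)) i<))

record Geodesic {V : Set} (R : V → V → Set) (k : ℕ) (x y : V) : Set where
  field
    at₀       : ℕ → V
    start     : at₀ 0 ≡ x
    end       : at₀ k ≡ y
    step      : ∀ s → s < k → R (at₀ s) (at₀ (suc s))
    inj       : ∀ s t → s < t → t ≤ k → at₀ s ≢ at₀ t
    chordless : ∀ s t → s < t → t ≤ k → R (at₀ s) (at₀ t) → t ≡ suc s

module _ {n : ℕ} {R : Fin n → Fin n → Set} (R? : ∀ x y → Dec (R x y)) where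

  wk? : ∀ k x y → Dec (Wk R k x y)
  wk? zero x y = map′ (λ { refl → nil }) (λ { nil → refl }) (x ≟ y)
  wk? (suc k) x y =
    map′ (λ { (z , r , w) → r ◃ w }) (λ { (r ◃ w) → _ , r , w })
      (Fin.any? λ z → R? x z ×-dec wk? k z y)

  -- In a walk of least length a repeated vertex would allow a stretch to be cut out, and a chord
  -- would be a shortcut.
  geodesic : ∀ {m x y} → Wk R m x y → ∃ λ k → k ≤ m × Geodesic R k x y
  geodesic {m} {x} {y} w with least (λ k → wk? k x y) m w
  ... | k , k≤m , v , min = k , k≤m , record
    { at₀ = at v ; start = refl ; end = at-end v ; step = at-step v
    ; inj = inj′ ; chordless = chordless′ }
    where
    seg : ∀ s d → s + d ≤ k → Wk R d (at v s) (at v (s + d))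
    seg s d le = segment (at v) s d λ i _ i< → at-step v i (ℕ.<-≤-trans i< le)
    tail : ∀ s r → k ≡ s + r → Wk R r (at v s) y
    tail s r refl = subst (Wk R r (at v s)) (at-end v) (seg s r ℕ.≤-refl)
    inj′ : ∀ s t → s < t → t ≤ k → at v s ≢ at v t
    inj′ s t s<t t≤k eq with <⇒∃+ s<t | ≤⇒∃+ t≤k
    ... | e , refl | r , k≡ =
      min (s + r) (subst (s + r <_) (sym k≡) (skip< s e r))
        (seg 0 s (ℕ.≤-trans (ℕ.<⇒≤ s<t) t≤k) ++
          subst (λ z → Wk R r z y) (sym eq) (tail (s + suc e) r k≡))
    chordless′ : ∀ s t → s < t → t ≤ k → R (at v s) (at v t) → t ≡ suc s
    chordless′ s t s<t t≤k rst with <⇒∃+ s<t | ≤⇒∃+ t≤k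
    ... | zero , refl | _ = ℕ.+-comm s 1
    ... | suc e , refl | r , k≡ =
      ⊥-elim (min (s + suc r) (subst (s + suc r <_) (sym k≡) (chord< s e r))
        (seg 0 s (ℕ.≤-trans (ℕ.<⇒≤ s<t) t≤k) ++ (rst ◃ tail (s + suc (suc e)) r k≡)))

split-sum : ∀ s e r → s + suc e + suc r ≡ suc e + (s + (0 + suc r))
split-sum s e r = solve (s ∷ e ∷ r ∷ [])

-- A chord belongs to both closed walks into which it splits a closed walk, so their total length
-- exceeds the original by two and keeps its parity.
chord-sum : ∀ s e r → 2 + (s + suc (suc e) + suc r) ≡ suc (suc (suc e)) + (s + (1 + suc r))
chord-sum s e r = solve (s ∷ e ∷ r ∷ [])

outer-length : ∀ e → suc (0 + suc (suc e)) ≡ 0 + suc (suc e) + 1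
outer-length e = solve (e ∷ [])

chord<₁ : ∀ s e r → 2 ≤ s + suc r → suc (suc (suc e)) < s + suc (suc e) + suc r
chord<₁ s e r le = linear 0 le (solve (s ∷ e ∷ r ∷ []))

-- Cycles as periodic sequences

-- With equal residues, a larger quotient would put `b` at least `suc k` beyond `a`.
window : ∀ k a b → a ≤ b → b < a + suc k → a % suc k ≡ b % suc k → a ≡ b
window k a b a≤b b< eq with ≤⇒∃+ (/-monoˡ-≤ (suc k) a≤b)
... | zero , q = trans (m≡m%n+[m/n]*n a (suc k))
       (trans (cong₂ (λ r p → r + p * suc k) eq (sym (trans q (ℕ.+-identityʳ _)))) (sym (m≡m%n+[m/n]*n b (suc k))))
... | suc p , q = ⊥-elim (ℕ.<⇒≱ b< (subst (a + suc k ≤_) (sym b≡) (ℕ.+-monoʳ-≤ a (ℕ.m≤m+n (suc k) (p * suc k)))))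
  where
  b≡ : b ≡ a + suc p * suc k
  b≡ = trans (m≡m%n+[m/n]*n b (suc k))
        (trans (cong₂ (λ r p → r + p * suc k) (sym eq) q)
        (trans (cong (a % suc k +_) (ℕ.*-distribʳ-+ (suc k) (a / suc k) (suc p)))
        (trans (sym (ℕ.+-assoc (a % suc k) _ _)) (cong (_+ suc p * suc k) (sym (m≡m%n+[m/n]*n a (suc k)))))))

module _ {n : ℕ} (G : Graph n) where

  Adj? : ∀ x y → Dec (Adj G x y)
  Adj? x y = adj G x y Bool.≟ true

  Adj-sym : ∀ {x y} → Adj G x y → Adj G y x
  Adj-sym {x} {y} = trans (adj-sym G y x)

  Adj⇒≢ : ∀ {x y} → Adj G x y → x ≢ y
  Adj⇒≢ {x} xy refl with trans (sym xy) (adj-irrefl G x)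
  ... | ()

  cycle : ∀ {k} (g : ℕ → Fin n) → 3 ≤ k →
    (∀ s → suc s < k → Adj G (g s) (g (suc s))) →
    (∀ s → suc s ≡ k → Adj G (g s) (g 0)) →
    (∀ s t → s < t → t < k → g s ≢ g t) →
    IsCycle G k (g ∘ toℕ)
  cycle {k} g 3≤k step close inj = 3≤k , inj′ , step′
    where
    inj′ : ∀ {i j : Fin k} → g (toℕ i) ≡ g (toℕ j) → i ≡ j
    inj′ {i} {j} eq with ℕ.<-cmp (toℕ i) (toℕ j)
    ... | tri< i<j _ _ = ⊥-elim (inj _ _ i<j (Fin.toℕ<n j) eq)
    ... | tri≈ _ i≡j _ = Fin.toℕ-injective i≡j
    ... | tri> _ _ j<i = ⊥-elim (inj _ _ j<i (Fin.toℕ<n i) (sym eq))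
    step′ : ∀ i j → Consec k i j → Adj G (g (toℕ i)) (g (toℕ j))
    step′ i j (inj₁ eq) = subst (λ t → Adj G (g (toℕ i)) (g t)) eq
      (step (toℕ i) (subst (_< k) (sym eq) (Fin.toℕ<n j)))
    step′ i j (inj₂ (eq , j≡0)) = subst (λ t → Adj G (g (toℕ i)) (g t)) (sym j≡0) (close (toℕ i) eq)

  inducedCycle : ∀ {k} (g : ℕ → Fin n) → IsCycle G k (g ∘ toℕ) →
    (∀ s t → s < t → t < k → Adj G (g s) (g t) → t ≡ suc s ⊎ (s ≡ 0 × suc t ≡ k)) →
    IsInducedCycle G k (g ∘ toℕ)
  inducedCycle {k} g cyc chord = cyc , chord′
    where
    one : ∀ (i j : Fin k) → toℕ i < toℕ j → Adj G (g (toℕ i)) (g (toℕ j)) → Consec k i j ⊎ Consec k j i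
    one i j i<j a with chord _ _ i<j (Fin.toℕ<n j) a
    ... | inj₁ eq = inj₁ (inj₁ (sym eq))
    ... | inj₂ (eq₀ , eq₁) = inj₂ (inj₂ (eq₁ , eq₀))
    chord′ : ∀ (i j : Fin k) → Adj G (g (toℕ i)) (g (toℕ j)) → Consec k i j ⊎ Consec k j i
    chord′ i j a with ℕ.<-cmp (toℕ i) (toℕ j)
    ... | tri< i<j _ _ = one i j i<j a
    ... | tri≈ _ i≡j _ = ⊥-elim (Adj⇒≢ a (cong g i≡j))
    ... | tri> _ _ j<i with one j i j<i (Adj-sym a)
    ...   | inj₁ p = inj₂ p
    ...   | inj₂ p = inj₁ p

  -- A cycle of length k as a k-periodic sequence, so that rotating it is a shift of the index.
  record Cyclic (k : ℕ) (c : ℕ → Fin n) : Set where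
    field
      periodic  : ∀ s → c (s + k) ≡ c s
      step      : ∀ s → Adj G (c s) (c (suc s))
      inj       : ∀ s t → s < t → t < s + k → c s ≢ c t
      chordless : ∀ s t → s < t → t < s + k → Adj G (c s) (c t) → t ≡ suc s ⊎ suc t ≡ s + k

  -- Indices are read modulo the length; `window` turns equal residues back into equal indices.
  cyclic : ∀ {k} {c : Fin (suc k) → Fin n} → IsInducedCycle G (suc k) c →
           Cyclic (suc k) (λ s → c (fromℕ< (m%n<n s (suc k))))
  cyclic {k} {c} ((3≤k , c-inj , c-step) , c-chord) = record
    { periodic = λ s → cong c (Fin.toℕ-injective (trans (to% (s + suc k)) (trans ([m+n]%n≡m%n s (suc k)) (sym (to% s)))))
    ; step = λ s → c-step (fin s) (fin (suc s)) (suc-consec s)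
    ; inj = λ s t s<t t< eq → ℕ.<⇒≢ s<t (window k s t (ℕ.<⇒≤ s<t) t<
              (trans (sym (to% s)) (trans (cong toℕ (c-inj eq)) (to% t))))
    ; chordless = chord }
    where
    fin : ℕ → Fin (suc k)
    fin s = fromℕ< (m%n<n s (suc k))
    to% : ∀ s → toℕ (fin s) ≡ s % suc k
    to% s = Fin.toℕ-fromℕ< (m%n<n s (suc k))
    1<K : 1 < suc k
    1<K = ℕ.<-≤-trans (s≤s (s≤s z≤n)) 3≤k
    suc% : ∀ s → suc s % suc k ≡ suc (s % suc k) % suc k
    suc% s = trans (%-distribˡ-+ 1 s (suc k)) (cong (λ z → (z + s % suc k) % suc k) (m<n⇒m%n≡m 1<K))
    suc-consec : ∀ s → Consec (suc k) (fin s) (fin (suc s))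
    suc-consec s with ℕ.m≤n⇒m<n∨m≡n (m%n<n s (suc k))
    ... | inj₁ lt = inj₁ (trans (cong suc (to% s)) (trans (sym (m<n⇒m%n≡m lt)) (trans (sym (suc% s)) (sym (to% (suc s))))))
    ... | inj₂ eq = inj₂ (trans (cong suc (to% s)) eq
                         , trans (to% (suc s)) (trans (suc% s) (trans (cong (_% suc k) eq) (n%n≡0 (suc k)))))
    consec-suc : ∀ s t → Consec (suc k) (fin s) (fin t) → suc s % suc k ≡ t % suc k
    consec-suc s t (inj₁ eq) = trans (suc% s) (trans (cong (_% suc k) (trans (sym (cong suc (to% s))) (trans eq (to% t))))
                                (m<n⇒m%n≡m (m%n<n t (suc k))))
    consec-suc s t (inj₂ (eq , eq₀)) = trans (suc% s) (trans (cong (_% suc k) (trans (sym (cong suc (to% s))) eq))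
                                (trans (n%n≡0 (suc k)) (trans (sym eq₀) (to% t))))
    chord : ∀ s t → s < t → t < s + suc k → Adj G (c (fin s)) (c (fin t)) → t ≡ suc s ⊎ suc t ≡ s + suc k
    chord s t s<t t< a with c-chord (fin s) (fin t) a
    ... | inj₁ p = inj₁ (sym (window k (suc s) t s<t (ℕ.m<n⇒m<1+n t<) (consec-suc s t p)))
    ... | inj₂ p = inj₂ (window k (suc t) (s + suc k) t<
            (subst (s + suc k <_) (cong suc (ℕ.+-comm (suc k) t))
              (s≤s (subst (_≤ suc k + t) (ℕ.+-comm (suc k) s) (ℕ.+-monoʳ-≤ (suc k) (ℕ.<⇒≤ s<t)))))
            (trans (consec-suc t s p) (sym ([m+n]%n≡m%n s (suc k)))))

  module _ {k : ℕ} {c : ℕ → Fin n} (C : Cyclic k c) where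
    open Cyclic C

    shift : ∀ i → Cyclic k (λ s → c (i + s))
    shift i = record
      { periodic = λ s → trans (cong c (sym (ℕ.+-assoc i s k))) (periodic (i + s))
      ; step = λ s → subst (λ t → Adj G (c (i + s)) (c t)) (sym (ℕ.+-suc i s)) (step (i + s))
      ; inj = λ s t s<t t< → inj (i + s) (i + t) (ℕ.+-monoʳ-< i s<t) (lt s t t<)
      ; chordless = λ s t s<t t< a → map-⊎
          (λ eq → ℕ.+-cancelˡ-≡ i _ _ (trans eq (sym (ℕ.+-suc i s))))
          (λ eq → ℕ.+-cancelˡ-≡ i _ _ (trans (ℕ.+-suc i t) (trans eq (ℕ.+-assoc i s k))))
          (chordless (i + s) (i + t) (ℕ.+-monoʳ-< i s<t) (lt s t t<) a) }
      where
      lt : ∀ s t → t < s + k → i + t < i + s + k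
      lt s t t< = subst (i + t <_) (sym (ℕ.+-assoc i s k)) (ℕ.+-monoʳ-< i t<)

-- Induced subgraphs and shortest odd closed walks

Within : ∀ {n} → Graph n → (Fin n → Set) → Fin n → Fin n → Set
Within G Y x y = Adj G x y × Y x × Y y

module _ {n : ℕ} (G : Graph n) (Y : Fin n → Set) where

  within-sym : ∀ {x y} → Within G Y x y → Within G Y y x
  within-sym {x} {y} (a , p , q) = Adj-sym G {x} {y} a , q , p

  within? : (∀ x → Dec (Y x)) → ∀ x y → Dec (Within G Y x y)
  within? Y? x y = Adj? G x y ×-dec (Y? x ×-dec Y? y)

module _ {n : ℕ} {R : Fin n → Fin n → Set} (R? : ∀ x y → Dec (R x y))
         (R-sym : ∀ {x y} → R x y → R y x) where

  private
    ClosedOdd : ℕ → Set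
    ClosedOdd m = Odd m × ∃ λ x → Wk R m x x

    closedOdd? : ∀ m → Dec (ClosedOdd m)
    closedOdd? m = (m % 2 ℕ.≟ 1) ×-dec Fin.any? λ x → wk? R? m x x

  -- Splitting a shortest odd closed walk at a repeated vertex or along a chord leaves a shorter one.
  shortestOddClosed : ∀ {m x} → Odd m → Wk R m x x →
    ∃ λ k → k ≤ m × Odd k × ∃ λ (g : ℕ → Fin n) → g k ≡ g 0 × (∀ s → s < k → R (g s) (g (suc s))) ×
      (∀ s t → s < t → t < k → g s ≢ g t) ×
      (∀ s t → s < t → t < k → R (g s) (g t) → t ≡ suc s ⊎ (s ≡ 0 × suc t ≡ k))
  shortestOddClosed {m} {x} odd-m w with least closedOdd? m (odd-m , x , w)
  ... | k , k≤m , (odd-k , y , v) , min =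
    k , k≤m , odd-k , at v , at-end v , at-step v , inj , chord
    where
    seg : ∀ s d → s + d ≤ k → Wk R d (at v s) (at v (s + d))
    seg s d le = segment (at v) s d λ i _ i< → at-step v i (ℕ.<-≤-trans i< le)
    around : ∀ s t r → s ≤ k → k ≡ t + r → ∀ {e} → Wk R e (at v s) (at v t) → Wk R (s + (e + r)) y y
    around s t r s≤k refl u = seg 0 s s≤k ++ (u ++ subst (Wk R r (at v t)) (at-end v) (seg t r ℕ.≤-refl))
    inj : ∀ s t → s < t → t < k → at v s ≢ at v t
    inj s t s<t t<k eq with <⇒∃+ s<t | <⇒∃+ t<k
    ... | e , refl | r , k≡ with odd-+ (suc e) (s + (0 + suc r)) (subst Odd (trans k≡ (split-sum s e r)) odd-k)
    ...   | inj₁ o = min (suc e) (ℕ.≤-<-trans (ℕ.m≤n+m (suc e) s) t<k)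
                      (o , _ , subst (Wk R (suc e) (at v s)) (sym eq) (seg s (suc e) (ℕ.<⇒≤ t<k)))
    ...   | inj₂ o = min (s + suc r) (subst (s + suc r <_) (sym k≡) (skip< s e (suc r)))
                      (o , _ , around s (s + suc e) (suc r) (ℕ.<⇒≤ (ℕ.<-trans s<t t<k)) k≡ (subst (Wk R 0 _) eq nil))
    chord : ∀ s t → s < t → t < k → R (at v s) (at v t) → t ≡ suc s ⊎ (s ≡ 0 × suc t ≡ k)
    chord s t s<t t<k a with <⇒∃+ s<t | <⇒∃+ t<k
    ... | zero , refl | r , k≡ = inj₁ (ℕ.+-comm s 1)
    ... | suc e , refl | r , k≡
      with odd-+ (suc (suc (suc e))) (s + (1 + suc r)) (subst Odd (trans (cong (2 +_) k≡) (chord-sum s e r)) odd-k)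
    ...   | inj₂ o = ⊥-elim (min (s + suc (suc r)) (subst (s + suc (suc r) <_) (sym k≡) (chord< s e (suc r)))
                      (o , _ , around s (s + suc (suc e)) (suc r) (ℕ.<⇒≤ (ℕ.<-trans s<t t<k)) k≡ (a ◃ nil)))
    -- The stretch closed off by the chord is odd, so by minimality it is not shorter than the whole
    -- walk. This leaves only the positions 0 and `k - 1`, whose chord is the closing edge.
    ...   | inj₁ o = outer s r refl k≡
      where
      shorter : ¬ suc (suc (suc e)) < k
      shorter lt = min _ lt (o , _ , snoc (seg s (suc (suc e)) (ℕ.<⇒≤ t<k)) (R-sym a))
      outer : ∀ s′ r′ → s′ ≡ s → k ≡ s′ + suc (suc e) + suc r′ → s + suc (suc e) ≡ suc s ⊎ (s ≡ 0 × suc (s + suc (suc e)) ≡ k)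
      outer zero zero refl q = inj₂ (refl , trans (outer-length e) (sym q))
      outer zero (suc r′) refl q = ⊥-elim (shorter (subst (_ <_) (sym q) (chord<₁ 0 e (suc r′) (s≤s (s≤s z≤n)))))
      outer (suc s′) r′ refl q = ⊥-elim (shorter (subst (_ <_) (sym q)
        (chord<₁ (suc s′) e r′ (s≤s (ℕ.≤-trans (s≤s z≤n) (ℕ.m≤n+m (suc r′) s′))))))

-- Components and bipartiteness

module _ {n : ℕ} {R : Fin n → Fin n → Set} (R? : ∀ x y → Dec (R x y))
         (R-sym : ∀ {x y} → R x y → R y x) where

  private
    Labelling : List (Fin n × Fin n) → Set
    Labelling es = ∃ λ (r : Fin n → Fin n) → (∀ x → ∃ λ k → Wk R k (r x) x) ×
                     All (λ (x , y) → R x y → r x ≡ r y) es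

    -- The class labelled `r v` is relabelled `r u`; its vertices are reached from `r u` by crossing
    -- the edge from `u` to `v`.
    merge : (u v : Fin n) → R u v → (r : Fin n → Fin n) → (∀ x → ∃ λ k → Wk R k (r x) x) →
      ∃ λ (r′ : Fin n → Fin n) → (∀ x → ∃ λ k → Wk R k (r′ x) x) ×
        (∀ x y → r x ≡ r y → r′ x ≡ r′ y) × r′ u ≡ r′ v
    merge u v uv r walks = (redirect ∘ r) , walks′ , (λ x y eq → cong redirect eq) , joins
      where
      redirect : Fin n → Fin n
      redirect z with z ≟ r v
      ... | yes _ = r u
      ... | no  _ = z
      walks′ : ∀ x → ∃ λ k → Wk R k (redirect (r x)) x
      walks′ x with r x ≟ r v
      ... | no  _  = walks x
      ... | yes eq = _ , proj₂ (walks u) ++ uv ◃ reverse R-sym (proj₂ (walks v)) ++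
                         subst (λ z → Wk R _ z x) eq (proj₂ (walks x))
      joins : redirect (r u) ≡ redirect (r v)
      joins with r u ≟ r v | r v ≟ r v
      ... | yes _ | yes _ = refl
      ... | no  _ | yes _ = refl
      ... | _     | no ¬p = ⊥-elim (¬p refl)

    -- Union-find: each related pair merges two classes, and equalities obtained earlier survive
    -- since relabelling acts on labels only.
    labelling : ∀ es → Labelling es
    labelling [] = (λ x → x) , (λ x → 0 , nil) , All.[]
    labelling ((u , v) ∷ es) with labelling es | R? u v
    ... | r , walks , ok | no ¬uv = r , walks , (λ uv → ⊥-elim (¬uv uv)) All.∷ ok
    ... | r , walks , ok | yes uv with merge u v uv r walks
    ...   | r′ , walks′ , mono , joins =
      r′ , walks′ , (λ _ → joins) All.∷ All.map (λ eq xy → mono _ _ (eq xy)) ok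

  components : ∃ λ (r : Fin n → Fin n) → (∀ x → ∃ λ k → Wk R k (r x) x) × (∀ x y → R x y → r x ≡ r y)
  components with labelling (cartesianProduct (allFin n) (allFin n))
  ... | r , walks , ok = r , walks , λ x y → All.lookup ok (∈-cartesianProduct⁺ (∈-allFin x) (∈-allFin y))

parity : ℕ → Bool
parity zero    = false
parity (suc k) = not (parity k)

parity-+ : ∀ k l → parity (k + l) ≡ parity k xor parity l
parity-+ zero    l = refl
parity-+ (suc k) l = trans (cong not (parity-+ k l)) (Bool.not-distribˡ-xor (parity k) (parity l))

parity⇒odd : ∀ k → parity k ≡ true → Odd k
parity⇒odd (suc zero)    _  = refl
parity⇒odd (suc (suc k)) eq with odd⇒ k (parity⇒odd k (trans (sym (Bool.not-involutive (parity k))) eq))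
... | j , refl = 1+2j-odd (suc j)

xor-not : ∀ b → b xor not b ≡ true
xor-not false = refl
xor-not true  = refl

module _ {n : ℕ} {R : Fin n → Fin n → Set} (R? : ∀ x y → Dec (R x y))
         (R-sym : ∀ {x y} → R x y → R y x) where

  -- Vertices are coloured by the parity of a walk from their representative. The two walks to the
  -- ends of a monochromatic edge form an odd closed walk with it.
  bipartite⊎oddClosed : (∃ λ (f : Fin n → Bool) → ∀ x y → R x y → f x ≢ f y) ⊎
                        (∃ λ m → ∃ λ x → Odd m × Wk R m x x)
  bipartite⊎oddClosed with components R? R-sym
  ... | r , walks , same with Fin.any? (λ x → Fin.any? λ y → R? x y ×-dec (f x Bool.≟ f y))
    where
    f : Fin n → Bool
    f x = parity (proj₁ (walks x))
  ... | no none = inj₁ ((λ x → parity (proj₁ (walks x))) , λ x y xy eq → none (x , y , xy , eq))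
  ... | yes (x , y , xy , eq) = inj₂ (k + suc l , r x , odd , proj₂ (walks x) ++ xy ◃ 
          reverse R-sym (subst (λ z → Wk R l z y) (sym (same x y xy)) (proj₂ (walks y))))
    where
    k l : ℕ
    k = proj₁ (walks x)
    l = proj₁ (walks y)
    odd : Odd (k + suc l)
    odd = parity⇒odd (k + suc l) (trans (parity-+ k (suc l)) (trans (cong (λ b → parity k xor not b) (sym eq)) (xor-not (parity k))))

-- Translation between the two forms of walks

module _ {n : ℕ} {R : Fin n → Fin n → Set} where

  fromSequence : ∀ k (w : Fin (suc k) → Fin n) → (∀ i → R (w (inject₁ i)) (w (fsuc i))) →
                 Wk R k (w fzero) (w (fromℕ k))
  fromSequence zero    w step = nil
  fromSequence (suc k) w step = step fzero ◃ fromSequence k (w ∘ fsuc) (step ∘ fsuc)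

module _ {n : ℕ} (G : Graph n) where

  walk⇒wk : ∀ {k x y} → Walk G k x y → Wk (Adj G) k x y
  walk⇒wk {k} (w , refl , refl , step) = fromSequence k w step

  wk⇒walk : ∀ {k x y} → Wk (Adj G) k x y → Walk G k x y
  wk⇒walk {k} w = (at w ∘ toℕ) , refl , trans (cong (at w) (Fin.toℕ-fromℕ k)) (at-end w)
    , λ i → subst (λ s → Adj G (at w s) (at w (suc (toℕ i)))) (sym (Fin.toℕ-inject₁ i)) (at-step w (toℕ i) (Fin.toℕ<n i))

-- Distance levels

module Levels {n : ℕ} (G : Graph n) (S : Subset n) where

  Near : ℕ → Fin n → Set
  Near i x = ∃ λ y → y ∈ S × Wk (Adj G) i x y

  near? : ∀ i x → Dec (Near i x)
  near? i x = Fin.any? λ y → (y ∈? S) ×-dec wk? (Adj? G) i x y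

  level⇒near : ∀ {i x} → Level G S i x → Near i x
  level⇒near ((y , y∈S , w) , _) = y , y∈S , walk⇒wk G w

  level⇒min : ∀ {i x} → Level G S i x → ∀ {j} → Near j x → i ≤ j
  level⇒min (_ , min) {j} (y , y∈S , w) = ℕ.≮⇒≥ λ j<i → min j j<i y y∈S (wk⇒walk G w)

  mkLevel : ∀ {i x} → Near i x → (∀ j → j < i → ¬ Near j x) → Level G S i x
  mkLevel (y , y∈S , w) min = (y , y∈S , wk⇒walk G w) , λ j j<i z z∈S v → min j j<i (z , z∈S , walk⇒wk G v)

  abstract
    level? : ∀ i x → Dec (Level G S i x)
    level? i x = map′ to from (near? i x ×-dec ℕ.allUpTo? (λ j → ¬? (near? j x)) i)
      where
      to : Near i x × (∀ {j} → j < i → ¬ Near j x) → Level G S i x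
      to (nr , min) = mkLevel nr λ j → min
      from : Level G S i x → Near i x × (∀ {j} → j < i → ¬ Near j x)
      from p = level⇒near p , λ j<i nr → ℕ.<⇒≱ j<i (level⇒min p nr)

  near⇒level : ∀ {i x} → Near i x → ∃ λ j → j ≤ i × Level G S j x
  near⇒level {i} {x} nr with least (λ j → near? j x) i nr
  ... | j , j≤i , nr′ , min = j , j≤i , mkLevel nr′ min

  level-unique : ∀ {i j x} → Level G S i x → Level G S j x → i ≡ j
  level-unique p q = ℕ.≤-antisym (level⇒min p (level⇒near q)) (level⇒min q (level⇒near p))

  level-step : ∀ {i j x y} → Level G S i x → Adj G x y → Level G S j y → j ≤ suc i
  level-step p xy q with level⇒near p
  ... | z , z∈S , w = level⇒min q (z , z∈S , (Adj-sym G xy ◃ w))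

  parent : ∀ {i x} → Level G S (suc i) x → ∃ λ y → Adj G x y × Level G S i y
  parent {i} p with level⇒near p
  ... | z , z∈S , _◃_ {y = y} xy w with near⇒level {i} {y} (z , z∈S , w)
  ...   | j , j≤i , q = y , xy , subst (λ k → Level G S k y) (ℕ.≤-antisym j≤i (ℕ.≤-pred (level-step q (Adj-sym G xy) p))) q

  -- The parent is chosen by a function of the vertex, so that the parents along a periodic sequence
  -- are periodic. Off level `suc i` the value is a dummy.
  parentOf : ∀ i → Fin n → Fin n
  parentOf i x with level? (suc i) x
  ... | yes p = proj₁ (parent p)
  ... | no  _ = x

  parentOf-spec : ∀ {i x} → Level G S (suc i) x → Adj G x (parentOf i x) × Level G S i (parentOf i x)
  parentOf-spec {i} {x} q with level? (suc i) x
  ... | yes p = proj₂ (parent p)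
  ... | no ¬p = ⊥-elim (¬p q)

  level-0 : ∀ {x} → x ∈ S → Level G S 0 x
  level-0 {x} x∈S = mkLevel (x , x∈S , nil) λ _ ()

  ∈-0 : ∀ {x} → Level G S 0 x → x ∈ S
  ∈-0 p with level⇒near p
  ... | z , z∈S , nil = z∈S

  Low : ℕ → Fin n → Set
  Low i x = ∃ λ j → j < suc i × Level G S j x

  low? : ∀ i x → Dec (Low i x)
  low? i x = ℕ.anyUpTo? (λ j → level? j x) (suc i)

  low-suc : ∀ {i x} → Low i x → Low (suc i) x
  low-suc (j , j≤i , p) = j , ℕ.m<n⇒m<1+n j≤i , p

  top : ∀ {i x} → Level G S i x → Low i x
  top p = _ , ℕ.≤-refl , p

  low-apart : ∀ {i x} → Low i x → ¬ Level G S (suc i) x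
  low-apart (j , j≤i , p) q = ℕ.<⇒≢ j≤i (level-unique p q)

  low-nonadjacent : ∀ {i x y} → Low i x → Level G S (suc (suc i)) y → ¬ Adj G x y
  low-nonadjacent (j , j≤i , p) q xy = ℕ.<⇒≱ (s≤s j≤i) (level-step p xy q)

  module _ {Y : Fin n → Set} where

    descend : ∀ i {x} → Level G S i x → Y x → (∀ {j z} → j < i → Level G S j z → Y z) →
              ∃ λ k → ∃ λ y → y ∈ S × Y y × Wk (Within G Y) k x y
    descend zero    {x} p yx below = 0 , x , ∈-0 p , yx , nil
    descend (suc i) p yx below with parent p
    ... | y , xy , q with descend i q (below ℕ.≤-refl q) (λ j<i → below (ℕ.m<n⇒m<1+n j<i))
    ...   | k , z , z∈S , yz , w = suc k , z , z∈S , yz , (xy , yx , below ℕ.≤-refl q) ◃ w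

    abstract
      -- Both ends descend to `S`, and the two feet are joined inside the connected set `S`. Hence
      -- `Y` has to contain just `S`, the ends and the levels strictly below each end.
      connect : InducedConnected G S → (∀ {z} → z ∈ S → Y z) →
                ∀ {i j x y} → Level G S i x → Level G S j y → Y x → Y y →
                (∀ {k z} → k < i → Level G S k z → Y z) → (∀ {k z} → k < j → Level G S k z → Y z) →
                ∃ λ k → Wk (Within G Y) k x y
      connect (_ , conn) S⊆Y {i} {j} p q yx yy belowᵢ belowⱼ with descend i p yx belowᵢ | descend j q yy belowⱼ
      ... | _ , s , s∈S , _ , v | _ , t , t∈S , _ , w with conn s t s∈S t∈S
      ...   | k , (u , refl , refl , step) , u∈S =
        _ , v ++ fromSequence k u (λ j → step j , S⊆Y (u∈S (inject₁ j)) , S⊆Y (u∈S (fsuc j))) ++ reverse (within-sym G Y) w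

-- Arithmetic of odd lengths

double-≤ : ∀ {m n} → m ≤ n → m + m ≤ n + n
double-≤ m≤n = ℕ.+-mono-≤ m≤n m≤n

odd≡ : ∀ j → 1 + j * 2 ≡ 2 * j + 1
odd≡ j = solve (j ∷ [])

odd< : ∀ j ℓ → j < ℓ → 1 + j * 2 < 2 * ℓ + 1
odd< j ℓ j<ℓ = linear 1 (double-≤ j<ℓ) (solve (j ∷ ℓ ∷ []))

odd> : ∀ j ℓ → ℓ < j → 2 * ℓ + 3 ≤ 1 + j * 2
odd> j ℓ ℓ<j = linear 0 (double-≤ ℓ<j) (solve (j ∷ ℓ ∷ []))

4≤2ℓ+3 : ∀ ℓ → 2 ≤ ℓ → 4 ≤ 2 * ℓ + 3
4≤2ℓ+3 ℓ 2≤ℓ = linear 3 (double-≤ 2≤ℓ) (solve (ℓ ∷ []))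

-- Edge deletion and induced paths

module _ {n : ℕ} (G : Graph n) where

  private
    -- The four decisions are arguments, in the shape to which adjacency in `deleteEdge` unfolds, so
    -- that the Boolean test computes by cases.
    decode : ∀ {x y u v : Fin n} b (p : Dec (x ≡ u)) (q : Dec (y ≡ v)) (r : Dec (x ≡ v)) (s : Dec (y ≡ u)) →
      b ∧ not ((⌊ p ⌋ ∧ ⌊ q ⌋) ∨ (⌊ r ⌋ ∧ ⌊ s ⌋)) ≡ true → b ≡ true × ¬ SamePair x y u v
    decode true (no ¬p) _       (no ¬r) _       _ = refl , λ { (inj₁ (p , _)) → ¬p p ; (inj₂ (r , _)) → ¬r r }
    decode true (no ¬p) _       (yes _) (no ¬s) _ = refl , λ { (inj₁ (p , _)) → ¬p p ; (inj₂ (_ , s)) → ¬s s }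
    decode true (yes _) (no ¬q) (no ¬r) _       _ = refl , λ { (inj₁ (_ , q)) → ¬q q ; (inj₂ (r , _)) → ¬r r }
    decode true (yes _) (no ¬q) (yes _) (no ¬s) _ = refl , λ { (inj₁ (_ , q)) → ¬q q ; (inj₂ (_ , s)) → ¬s s }

    encode : ∀ {x y u v : Fin n} b (p : Dec (x ≡ u)) (q : Dec (y ≡ v)) (r : Dec (x ≡ v)) (s : Dec (y ≡ u)) →
      b ≡ true → ¬ SamePair x y u v → b ∧ not ((⌊ p ⌋ ∧ ⌊ q ⌋) ∨ (⌊ r ⌋ ∧ ⌊ s ⌋)) ≡ true
    encode true (yes p) (yes q) _       _       _ ¬same = ⊥-elim (¬same (inj₁ (p , q)))
    encode true _       _       (yes r) (yes s) _ ¬same = ⊥-elim (¬same (inj₂ (r , s)))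
    encode true (no _)  _       (no _)  _       _ _     = refl
    encode true (no _)  _       (yes _) (no _)  _ _     = refl
    encode true (yes _) (no _)  (no _)  _       _ _     = refl
    encode true (yes _) (no _)  (yes _) (no _)  _ _     = refl

  deleteEdge⁻ : ∀ u v x y → Adj (deleteEdge G u v) x y → Adj G x y × ¬ SamePair x y u v
  deleteEdge⁻ u v x y = decode (adj G x y) (x ≟ u) (y ≟ v) (x ≟ v) (y ≟ u)

  deleteEdge⁺ : ∀ u v x y → Adj G x y → ¬ SamePair x y u v → Adj (deleteEdge G u v) x y
  deleteEdge⁺ u v x y = encode (adj G x y) (x ≟ u) (y ≟ v) (x ≟ v) (y ≟ u)

  record OtherEdge (u v x y : Fin n) : Set where
    constructor other
    field
      edge  : Adj G x y
      ¬same : ¬ SamePair x y u v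

  otherEdge? : ∀ u v x y → Dec (OtherEdge u v x y)
  otherEdge? u v x y = map′ (λ (p , q) → other p q) (λ (other p q) → p , q)
    (Adj? G x y ×-dec ¬? (((x ≟ u) ×-dec (y ≟ v)) ⊎-dec ((x ≟ v) ×-dec (y ≟ u))))

  otherˡ : ∀ {u v x y} → Adj G x y → x ≢ u → x ≢ v → OtherEdge u v x y
  otherˡ xy x≢u x≢v = other xy λ { (inj₁ (x≡u , _)) → x≢u x≡u ; (inj₂ (x≡v , _)) → x≢v x≡v }

  otherʳ : ∀ {u v x y} → Adj G x y → y ≢ u → y ≢ v → OtherEdge u v x y
  otherʳ xy y≢u y≢v = other xy λ { (inj₁ (_ , y≡v)) → y≢v y≡v ; (inj₂ (_ , y≡u)) → y≢u y≡u }

  record InducedPath (k : ℕ) (g : ℕ → Fin n) : Set where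
    field
      step      : ∀ s → s < k → Adj G (g s) (g (suc s))
      inj       : ∀ s t → s < t → t ≤ k → g s ≢ g t
      chordless : ∀ s t → s < t → t ≤ k → Adj G (g s) (g t) → t ≡ suc s

  reversePath : ∀ {k g} → InducedPath k g → InducedPath k (λ s → g (k ∸ s))
  reversePath {k} {g} P = record { step = step′ ; inj = inj′ ; chordless = chordless′ }
    where
    open InducedPath P
    step′ : ∀ s → s < k → Adj G (g (k ∸ s)) (g (k ∸ suc s))
    step′ s s<k = Adj-sym G (subst (λ t → Adj G (g (k ∸ suc s)) (g t)) (sym (ℕ.+-∸-assoc 1 s<k))
                    (step (k ∸ suc s) (subst (_≤ k) (ℕ.+-∸-assoc 1 s<k) (ℕ.m∸n≤m k s))))
    inj′ : ∀ s t → s < t → t ≤ k → g (k ∸ s) ≢ g (k ∸ t)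
    inj′ s t s<t t≤k eq = inj (k ∸ t) (k ∸ s) (ℕ.∸-monoʳ-< s<t t≤k) (ℕ.m∸n≤m k s) (sym eq)
    chordless′ : ∀ s t → s < t → t ≤ k → Adj G (g (k ∸ s)) (g (k ∸ t)) → t ≡ suc s
    chordless′ s t s<t t≤k a =
      ℕ.∸-cancelˡ-≡ t≤k (ℕ.<-≤-trans s<t t≤k)
        (ℕ.suc-injective (trans (sym (chordless (k ∸ t) (k ∸ s) (ℕ.∸-monoʳ-< s<t t≤k) (ℕ.m∸n≤m k s) (Adj-sym G a)))
                                (ℕ.+-∸-assoc 1 (ℕ.<-≤-trans s<t t≤k))))

  -- The bound leaves at least one vertex of the cycle off the arc, which rules out the closing edge
  -- as a chord.
  arc : ∀ {k c} → Cyclic G k c → ∀ i d → suc (suc d) ≤ k → InducedPath d (λ s → c (i + s))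
  arc {k} {c} C i d d< = record
    { step = λ s _ → step s
    ; inj = λ s t s<t t≤d → inj s t s<t (ℕ.<-≤-trans (ℕ.<-trans (s≤s t≤d) d<) (ℕ.m≤n+m k s))
    ; chordless = chordless′ }
    where
    open Cyclic (shift G C i)
    chordless′ : ∀ s t → s < t → t ≤ d → Adj G (c (i + s)) (c (i + t)) → t ≡ suc s
    chordless′ s t s<t t≤d a with chordless s t s<t (ℕ.<-≤-trans (ℕ.<-trans (s≤s t≤d) d<) (ℕ.m≤n+m k s)) a
    ... | inj₁ eq = eq
    ... | inj₂ eq = ⊥-elim (ℕ.<⇒≱ (ℕ.≤-<-trans (s≤s t≤d) d<) (subst (k ≤_) (sym eq) (ℕ.m≤n+m k s)))

  abstract
    -- A geodesic of the subgraph induced by `Y` is an induced path of `G`, since a chord in `G`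
    -- would have both ends in `Y`.
    geodesicWithin : ∀ {Y : Fin n → Set} → (∀ x → Dec (Y x)) → ∀ {m x y} → x ≢ y → Wk (Within G Y) m x y →
      ∃ λ k → suc k ≤ m × ∃ λ g → g 0 ≡ x × g (suc k) ≡ y × InducedPath (suc k) g × (∀ s → s ≤ suc k → Y (g s))
    geodesicWithin {Y} Y? x≢y w with geodesic (within? G Y Y?) w
    ... | zero , _ , P = ⊥-elim (x≢y (trans (sym (Geodesic.start P)) (Geodesic.end P)))
    ... | suc k , k≤m , P = k , k≤m , at₀ , start , end , record
          { step = λ s s<k → proj₁ (step s s<k) ; inj = inj
          ; chordless = λ s t s<t t≤k a → chordless s t s<t t≤k (a , inside s (ℕ.≤-trans (ℕ.<⇒≤ s<t) t≤k) , inside t t≤k) } , inside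
      where
      open Geodesic P
      inside : ∀ s → s ≤ suc k → Y (at₀ s)
      inside zero    _   = proj₁ (proj₂ (step 0 (s≤s z≤n)))
      inside (suc s) s≤k = proj₂ (proj₂ (step s s≤k))

-- Gluing two induced paths to an induced cycle

module _ {V : Set} where

  join : ℕ → (ℕ → V) → (ℕ → V) → ℕ → V
  join a       α β zero    = α 0
  join zero    α β (suc s) = β s
  join (suc a) α β (suc s) = join a (α ∘ suc) β s

  joinˡ : ∀ a α β s → s ≤ a → join a α β s ≡ α s
  joinˡ a       α β zero    _         = refl
  joinˡ (suc a) α β (suc s) (s≤s s≤a) = joinˡ a (α ∘ suc) β s s≤a

  joinʳ : ∀ a α β t → join a α β (suc a + t) ≡ β t
  joinʳ zero    α β t = refl
  joinʳ (suc a) α β t = joinʳ a (α ∘ suc) β t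

locate : ∀ a b s → s < suc a + suc b → s ≤ a ⊎ ∃ λ t → s ≡ suc a + t × t ≤ b
locate a b s s< with s ≤? a
... | yes s≤a = inj₁ s≤a
... | no  s≰a with ≤⇒∃+ (ℕ.≰⇒> s≰a)
...   | t , refl = inj₂ (t , refl , ℕ.≤-pred (ℕ.+-cancelˡ-< (suc a) t (suc b) s<))

module _ {n : ℕ} (G : Graph n) {a b : ℕ} {α β : ℕ → Fin n} (A : InducedPath G a α) (B : InducedPath G b β)
  (disjoint : ∀ s t → s ≤ a → t ≤ b → α s ≢ β t)
  (cross : ∀ s t → s ≤ a → t ≤ b → Adj G (α s) (β t) → (s ≡ a × t ≡ 0) ⊎ (s ≡ 0 × t ≡ b))
  (αβ : Adj G (α a) (β 0)) (βα : Adj G (β b) (α 0)) (1≤a : 1 ≤ a) where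

  private
    module A = InducedPath A
    module B = InducedPath B
    g : ℕ → Fin n
    g = join a α β
    gα : ∀ {s} → s ≤ a → g s ≡ α s
    gα = joinˡ a α β _
    gβ : ∀ t → g (suc a + t) ≡ β t
    gβ = joinʳ a α β
    Adj-≡ : ∀ {x x′ y y′} → x ≡ x′ → y ≡ y′ → Adj G x′ y′ → Adj G x y
    Adj-≡ refl refl p = p

    step : ∀ s → suc s < suc a + suc b → Adj G (g s) (g (suc s))
    step s s< with locate a b (suc s) s<
    ... | inj₁ s<a = Adj-≡ (gα (ℕ.<⇒≤ s<a)) (gα s<a) (A.step s s<a)
    ... | inj₂ (zero , eq , _) = Adj-≡ (gα s≤a) (trans (cong g eq) (gβ 0)) (subst (λ z → Adj G (α z) (β 0)) (sym s≡a) αβ)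
      where
      s≡a : s ≡ a
      s≡a = ℕ.suc-injective (trans eq (cong suc (ℕ.+-identityʳ a)))
      s≤a : s ≤ a
      s≤a = ℕ.≤-reflexive s≡a
    ... | inj₂ (suc t , eq , t<b) = Adj-≡
            (trans (cong g (ℕ.suc-injective (trans eq (cong suc (ℕ.+-suc a t))))) (gβ t))
            (trans (cong g eq) (gβ (suc t))) (B.step t t<b)

    close : ∀ s → suc s ≡ suc a + suc b → Adj G (g s) (g 0)
    close s eq = Adj-≡ (trans (cong g (ℕ.suc-injective (trans eq (cong suc (ℕ.+-suc a b))))) (gβ b)) refl βα

    inj : ∀ s t → s < t → t < suc a + suc b → g s ≢ g t
    inj s t s<t t< eq with locate a b s (ℕ.<-trans s<t t<) | locate a b t t<
    ... | inj₁ s≤a | inj₁ t≤a = A.inj s t s<t t≤a (trans (sym (gα s≤a)) (trans eq (gα t≤a)))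
    ... | inj₁ s≤a | inj₂ (t′ , refl , t≤b) = disjoint s t′ s≤a t≤b (trans (sym (gα s≤a)) (trans eq (gβ t′)))
    ... | inj₂ (s′ , refl , _) | inj₁ t≤a = ℕ.<⇒≱ s<t (ℕ.≤-trans t≤a (ℕ.≤-trans (ℕ.n≤1+n a) (ℕ.m≤m+n (suc a) s′)))
    ... | inj₂ (s′ , refl , _) | inj₂ (t′ , refl , t≤b) =
      B.inj s′ t′ (ℕ.+-cancelˡ-< (suc a) s′ t′ s<t) t≤b (trans (sym (gβ s′)) (trans eq (gβ t′)))

    chord : ∀ s t → s < t → t < suc a + suc b → Adj G (g s) (g t) → t ≡ suc s ⊎ (s ≡ 0 × suc t ≡ suc a + suc b)
    chord s t s<t t< st with locate a b s (ℕ.<-trans s<t t<) | locate a b t t<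
    ... | inj₁ s≤a | inj₁ t≤a = inj₁ (A.chordless s t s<t t≤a (Adj-≡ (sym (gα s≤a)) (sym (gα t≤a)) st))
    ... | inj₂ (s′ , refl , _) | inj₁ t≤a = ⊥-elim (ℕ.<⇒≱ s<t (ℕ.≤-trans t≤a (ℕ.≤-trans (ℕ.n≤1+n a) (ℕ.m≤m+n (suc a) s′))))
    ... | inj₂ (s′ , refl , _) | inj₂ (t′ , refl , t≤b) = inj₁ (trans (cong (suc a +_)
            (B.chordless s′ t′ (ℕ.+-cancelˡ-< (suc a) s′ t′ s<t) t≤b (Adj-≡ (sym (gβ s′)) (sym (gβ t′)) st))) (ℕ.+-suc (suc a) s′))
    ... | inj₁ s≤a | inj₂ (t′ , refl , t≤b) with cross s t′ s≤a t≤b (Adj-≡ (sym (gα s≤a)) (sym (gβ t′)) st)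
    ...   | inj₁ (refl , refl) = inj₁ (ℕ.+-identityʳ (suc a))
    ...   | inj₂ (refl , refl) = inj₂ (refl , sym (ℕ.+-suc (suc a) b))

  -- Edges between the disjoint paths join only the end of one to the start of the other, so no
  -- chord runs across. The paths have `suc a` and `suc b` vertices, at least three together as
  -- `1 ≤ a`.
  glue : IsInducedCycle G (suc a + suc b) (g ∘ toℕ)
  glue = inducedCycle G g (cycle G g (s≤s (ℕ.+-mono-≤ 1≤a (s≤s z≤n))) step close inj) chord

-- Cycle lengths forced by the girth and the missing odd holes

module Girth {n : ℕ} (G : Graph n) (ℓ : ℕ) (2≤ℓ : 2 ≤ ℓ)
             (girth : ∀ k → k < 2 * ℓ + 1 → ¬ HasCycleOfLength G k) where

  -- A geodesic from `x` to `y` that avoids their edge closes up with it to a cycle. Short closed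
  -- walks are refuted in this way: one edge is singled out, and the rest is shown to avoid it.
  detour : ∀ {x y} → Adj G x y → ∀ {w} → Wk (OtherEdge G x y) w x y → 2 * ℓ ≤ w
  detour {x} {y} xy w with geodesic (otherEdge? G x y) w
  ... | zero , _ , P = ⊥-elim (Adj⇒≢ G xy (trans (sym (Geodesic.start P)) (Geodesic.end P)))
  ... | suc zero , _ , P =
    ⊥-elim (OtherEdge.¬same (Geodesic.step P 0 ℕ.≤-refl) (inj₁ (Geodesic.start P , Geodesic.end P)))
  ... | suc (suc k) , k≤w , P = ℕ.≤-trans
    (ℕ.≤-pred (subst (_≤ 3 + k) (ℕ.+-comm (2 * ℓ) 1) (ℕ.≮⇒≥ λ short → girth (3 + k) short (at₀ ∘ toℕ , cyc)))) k≤w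
    where
    open Geodesic P
    cyc : IsCycle G (3 + k) (at₀ ∘ toℕ)
    cyc = cycle G at₀ (s≤s (s≤s (s≤s z≤n)))
      (λ s s< → OtherEdge.edge (step s (ℕ.≤-pred s<)))
      (λ { s refl → subst₂ (Adj G) (sym end) (sym start) (Adj-sym G xy) })
      (λ s t s<t t< → inj s t s<t (ℕ.≤-pred t<))

  -- The girth excludes odd lengths below `2 * ℓ + 1`, the missing odd holes exclude those from
  -- `2 * ℓ + 3` on, and no odd number lies strictly between `2 * ℓ + 1` and `2 * ℓ + 3`.
  inducedLength : (∀ k (c : Fin k → Fin n) → 2 * ℓ + 3 ≤ k → ¬ IsOddHole G k c) →
    ∀ {k c} → IsInducedCycle G k c → 2 * ℓ + 1 ≤ k × (Odd k → k ≡ 2 * ℓ + 1)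
  inducedLength noHole {k} {c} C@(cyc , _) = long , exact
    where
    long : 2 * ℓ + 1 ≤ k
    long = ℕ.≮⇒≥ λ short → girth k short (c , cyc)
    exact : Odd k → k ≡ 2 * ℓ + 1
    exact odd with odd⇒ k odd
    ... | j , refl with ℕ.<-cmp j ℓ
    ...   | tri≈ _ refl _ = odd≡ j
    ...   | tri< j<ℓ _ _ = ⊥-elim (ℕ.<⇒≱ (odd< j ℓ j<ℓ) long)
    ...   | tri> _ _ ℓ<j = ⊥-elim (noHole _ c (odd> j ℓ ℓ<j) ((C , ℕ.≤-trans (4≤2ℓ+3 ℓ 2≤ℓ) (odd> j ℓ ℓ<j)) , odd))

-- Arithmetic of arcs and links

infixr 6 _⊕_

_⊕_ : ∀ {a b c d} → a ≤ b → c ≤ d → a + c ≤ b + d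
_⊕_ = ℕ.+-mono-≤

short-arith : ∀ ℓ e → 2 ≤ ℓ → e ≤ ℓ → 2 * ℓ ≤ suc e → 1 ≤ 0
short-arith ℓ e p q r = linear 0 (p ⊕ q ⊕ r) (solve (ℓ ∷ e ∷ []))

within-arith : ∀ ℓ a i e → e ≤ ℓ → i < a + e → suc i < a + (2 * ℓ + 1)
within-arith ℓ a i e p q = linear ℓ (p ⊕ q) (solve (ℓ ∷ a ∷ i ∷ e ∷ []))

ℓ<K : ∀ ℓ a e → e ≤ ℓ → a + e < a + (2 * ℓ + 1)
ℓ<K ℓ a e p = linear ℓ p (solve (ℓ ∷ a ∷ e ∷ []))

complement-arith : ∀ ℓ a e f → ℓ < suc e → a + suc e + suc f ≤ a + (2 * ℓ + 1) → suc f ≤ ℓ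
complement-arith ℓ a e f p q = linear 0 (p ⊕ q) (solve (ℓ ∷ a ∷ e ∷ f ∷ []))

-- The two cycles share the path and split the odd cycle between them, so the sum of their lengths
-- is odd.
two-arcs : ∀ ℓ d f m → d + f ≡ 2 * ℓ + 1 → suc ((ℓ + 2 + m) * 2) ≡ suc d + suc m + (suc f + suc m)
two-arcs ℓ d f m eq = trans (lem ℓ m) (trans (cong (λ z → z + (suc m + suc (suc m))) (cong (_+ 1) (sym eq))) (lem′ d f m))
  where
  lem : ∀ ℓ m → suc ((ℓ + 2 + m) * 2) ≡ 2 * ℓ + 1 + 1 + (suc m + suc (suc m))
  lem ℓ m = solve (ℓ ∷ m ∷ [])
  lem′ : ∀ d f m → d + f + 1 + (suc m + suc (suc m)) ≡ suc d + suc m + (suc f + suc m)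
  lem′ d f m = solve (d ∷ f ∷ m ∷ [])

short-link : ∀ ℓ d m → suc d + suc m ≡ 2 * ℓ + 1 → d + m + 1 ≡ 2 * ℓ
short-link ℓ d m eq = ℕ.+-cancelʳ-≡ 1 _ _ (trans (lem d m) eq)
  where
  lem : ∀ d m → d + m + 1 + 1 ≡ suc d + suc m
  lem d m = solve (d ∷ m ∷ [])

long-link : ∀ ℓ d f m → d + f ≡ 2 * ℓ + 1 → suc f + suc m ≡ 2 * ℓ + 1 → d ≤ ℓ → 2 * ℓ + 1 ≤ suc d + suc m → 1 ≤ 0
long-link ℓ d f m eq eq′ p q = linear 0 (ℕ.≤-reflexive (trans eq′ (sym eq)) ⊕ p ⊕ p ⊕ q) (solve (ℓ ∷ d ∷ f ∷ m ∷ []))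

arc-room : ∀ ℓ d f → d + f ≡ 2 * ℓ + 1 → 2 ≤ d → suc (suc f) ≤ 2 * ℓ + 1
arc-room ℓ d f eq p = linear 0 (p ⊕ ℕ.≤-reflexive eq) (solve (ℓ ∷ d ∷ f ∷ []))

arc-room′ : ∀ ℓ d → 2 ≤ ℓ → d ≤ ℓ → suc (suc d) ≤ 2 * ℓ + 1
arc-room′ ℓ d p q = linear 1 (p ⊕ q) (solve (ℓ ∷ d ∷ []))

1≤f-arith : ∀ ℓ d f → d + f ≡ 2 * ℓ + 1 → d ≤ ℓ → 1 ≤ f
1≤f-arith ℓ d f eq p = linear ℓ (p ⊕ ℕ.≤-reflexive (sym eq)) (solve (ℓ ∷ d ∷ f ∷ []))

-- If the cycle through the arc of length `d` is odd, its length is known. If the other one is odd,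
-- it has length `2 * ℓ + 1`, and since `d ≤ ℓ < f` the cycle through `d` would be shorter than the
-- girth.
link-length : ∀ ℓ d f m → d + f ≡ 2 * ℓ + 1 → d ≤ ℓ →
  2 * ℓ + 1 ≤ suc d + suc (suc m) × (Odd (suc d + suc (suc m)) → suc d + suc (suc m) ≡ 2 * ℓ + 1) →
  2 * ℓ + 1 ≤ suc f + suc (suc m) × (Odd (suc f + suc (suc m)) → suc f + suc (suc m) ≡ 2 * ℓ + 1) →
  d + suc m + 1 ≡ 2 * ℓ
link-length ℓ d f m d+f d≤ℓ (low , exact) (_ , exact′) =
  [ (λ o → short-link ℓ d (suc m) (exact o))
  , (λ o → ⊥-elim (ℕ.<⇒≱ (long-link ℓ d f (suc m) d+f (exact′ o) d≤ℓ low) z≤n)) ]′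
  (odd-+ (suc d + suc (suc m)) (suc f + suc (suc m))
    (subst Odd (two-arcs ℓ d f (suc m) d+f) (1+2j-odd (ℓ + 2 + suc m))))

link₂ : ∀ ℓ m → ℓ ≡ 2 → 2 + suc m + 1 ≡ 2 * ℓ → m ≡ 0
link₂ _ m refl eq = ℕ.+-cancelʳ-≡ 1 m 0 (ℕ.suc-injective (ℕ.suc-injective (ℕ.suc-injective eq)))

link₃,₂ : ∀ ℓ m → ℓ ≡ 3 → 2 + suc m + 1 ≡ 2 * ℓ → m ≡ 2
link₃,₂ _ m refl eq = ℕ.+-cancelʳ-≡ 1 m 2 (ℕ.suc-injective (ℕ.suc-injective (ℕ.suc-injective eq)))

link₃,₃ : ∀ ℓ m → ℓ ≡ 3 → 3 + suc m + 1 ≡ 2 * ℓ → m ≡ 1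
link₃,₃ _ m refl eq = ℕ.+-cancelʳ-≡ 1 m 1 (ℕ.suc-injective (ℕ.suc-injective (ℕ.suc-injective (ℕ.suc-injective eq))))

too-short : ∀ ℓ k → ℓ ≡ 3 → k ≤ 5 → ¬ 2 * ℓ ≤ k
too-short _ k refl k≤5 6≤k = ℕ.<⇒≱ 6≤k k≤5

wrap : ∀ ℓ → suc ℓ + ℓ ≡ 0 + (2 * ℓ + 1)
wrap ℓ = solve (ℓ ∷ [])

close-parents : ∀ ℓ m → 4 ≤ ℓ → ℓ + suc m + 1 ≡ 2 * ℓ → suc m ≤ 2 → 1 ≤ 0
close-parents ℓ m p eq q = linear 0 (p ⊕ ℕ.≤-reflexive (sym eq) ⊕ q) (solve (ℓ ∷ m ∷ []))

1≤link : ∀ ℓ m → 4 ≤ ℓ → ℓ + suc m + 1 ≡ 2 * ℓ → 1 ≤ m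
1≤link ℓ m p eq = linear 1 (p ⊕ ℕ.≤-reflexive (sym eq)) (solve (ℓ ∷ m ∷ []))

two-links : ∀ ℓ m m′ → ℓ + suc m + 1 ≡ 2 * ℓ → ℓ + suc m′ + 1 ≡ 2 * ℓ → 2 * ℓ ≤ suc (suc (m + m′)) → 1 ≤ 0
two-links ℓ m m′ eq eq′ p = linear 1 (ℕ.≤-reflexive eq ⊕ ℕ.≤-reflexive eq′ ⊕ p) (solve (ℓ ∷ m ∷ m′ ∷ []))

bool-≢ : ∀ {x y z : Bool} → x ≢ y → y ≢ z → x ≡ z
bool-≢ {false} {false} p q = ⊥-elim (p refl)
bool-≢ {false} {true} {false} p q = refl
bool-≢ {false} {true} {true} p q = ⊥-elim (q refl)
bool-≢ {true} {true} p q = ⊥-elim (p refl)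
bool-≢ {true} {false} {true} p q = refl
bool-≢ {true} {false} {false} p q = ⊥-elim (q refl)

-- A cycle of length 2ℓ + 1 inside one level

module Layer {n : ℕ} (G : Graph n) (ℓ : ℕ) (2≤ℓ : 2 ≤ ℓ)
  (girth : ∀ k → k < 2 * ℓ + 1 → ¬ HasCycleOfLength G k)
  (noHole : ∀ k (c : Fin k → Fin n) → 2 * ℓ + 3 ≤ k → ¬ IsOddHole G k c)
  (S : Subset n) (h : ℕ) (c : ℕ → Fin n) (C : Cyclic G (2 * ℓ + 1) c)
  (level-c : ∀ s → Level G S (suc (suc h)) (c s))
  (u : ℕ → Fin n) (u-adj : ∀ s → Adj G (c s) (u s)) (u-level : ∀ s → Level G S (suc h) (u s))
  (u-periodic : ∀ s → u (s + (2 * ℓ + 1)) ≡ u s) where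

  open Girth G ℓ 2≤ℓ girth public
  open Levels G S public
  open Cyclic C public

  private
    K : ℕ
    K = 2 * ℓ + 1

  low≢c : ∀ {y} → Low (suc h) y → ∀ s → y ≢ c s
  low≢c low s refl = low-apart low (level-c s)

  private
    -- The arc and the two edges at `y` form a cycle of length at most `ℓ + 2`, which is below the
    -- girth as `2 ≤ ℓ`.
    oneNeighbour-near : ∀ {y} → Low (suc h) y → ∀ a e → 1 ≤ e → e ≤ ℓ → Adj G y (c a) → Adj G y (c (a + e)) → ⊥
    oneNeighbour-near {y} low a e 1≤e e≤ℓ ya yb =
      ℕ.<⇒≱ (short-arith ℓ e 2≤ℓ e≤ℓ (detour (Adj-sym G ya) (snoc (segment c a e along) last))) z≤n
      where
      along : ∀ i → a ≤ i → i < a + e → OtherEdge G (c a) y (c i) (c (suc i))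
      along i a≤i i< = otherʳ G (step i)
        (λ eq → inj a (suc i) (s≤s a≤i) (within-arith ℓ a i e e≤ℓ i<) (sym eq))
        (λ eq → low≢c low (suc i) (sym eq))
      last : OtherEdge G (c a) y (c (a + e)) y
      last = otherˡ G (Adj-sym G yb)
        (λ eq → inj a (a + e) (ℕ.m<m+n a 1≤e) (ℓ<K ℓ a e e≤ℓ) (sym eq))
        (λ eq → low≢c low (a + e) (sym eq))

  -- One of the two arcs between the positions has at most `ℓ` edges; if it is the one from `b` to
  -- `a + K`, periodicity brings it into the form of the near case.
  oneNeighbour : ∀ {y} → Low (suc h) y → ∀ a b → a < b → b < a + K → Adj G y (c a) → Adj G y (c b) → ⊥
  oneNeighbour {y} low a b a<b b<a+K ya yb with <⇒∃+ a<b | <⇒∃+ b<a+K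
  ... | e , refl | f , eq with suc e ≤? ℓ
  ...   | yes e≤ℓ = oneNeighbour-near low a (suc e) (s≤s z≤n) e≤ℓ ya yb
  ...   | no  e≰ℓ = oneNeighbour-near low b (suc f) (s≤s z≤n)
                      (complement-arith ℓ a e f (ℕ.≰⇒> e≰ℓ) (ℕ.≤-reflexive (sym eq))) yb
                      (subst (Adj G y) (sym (trans (cong c (sym eq)) (periodic a))) ya)

  u-distinct : ∀ a b → a < b → b < a + K → u a ≢ u b
  u-distinct a b a<b b< eq = oneNeighbour (top (u-level a)) a b a<b b< (Adj-sym G (u-adj a))
    (subst (λ z → Adj G z (c b)) (sym eq) (Adj-sym G (u-adj b)))

  -- Extended by the edges to `c s` and `c (suc s)`, the walk is a detour around the edge between
  -- these two.
  neighbouringParents : ∀ s {k} → Wk (Within G (Low (suc h))) k (u s) (u (suc s)) → 2 * ℓ ≤ suc (suc k)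
  neighbouringParents s w = detour (step s)
    (otherʳ G (u-adj s) (low≢c (top (u-level s)) s) (low≢c (top (u-level s)) (suc s))
      ◃ snoc (mapWk (λ (xy , lx , _) → otherˡ G xy (low≢c lx s) (low≢c lx (suc s))) w)
             (otherˡ G (Adj-sym G (u-adj (suc s))) (low≢c (top (u-level (suc s))) s) (low≢c (top (u-level (suc s))) (suc s))))

  private
    -- The interior of the path is too low to have neighbours on the cycle, and each end has exactly
    -- one there, so arc and path glue to an induced cycle.
    closeUp : ∀ i e → 1 ≤ e → suc (suc e) ≤ K → ∀ m g → g 0 ≡ u (i + e) → g (suc m) ≡ u i →
      InducedPath G (suc m) g → (∀ s → 1 ≤ s → s ≤ m → Low h (g s)) →
      K ≤ suc e + suc (suc m) × (Odd (suc e + suc (suc m)) → suc e + suc (suc m) ≡ K)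
    closeUp i e 1≤e e< m g g₀ gₘ P interior =
      inducedLength noHole (glue G (arc G C i e e<) P disjoint cross αβ βα 1≤e)
      where
      e≤K : e < K
      e≤K = ℕ.<-trans (ℕ.n<1+n e) e<
      position : ∀ t → t ≤ suc m → t ≡ 0 ⊎ t ≡ suc m ⊎ Low h (g t)
      position zero    _   = inj₁ refl
      position (suc t) t≤m with ℕ.m≤n⇒m<n∨m≡n t≤m
      ... | inj₂ eq = inj₂ (inj₁ eq)
      ... | inj₁ lt = inj₂ (inj₂ (interior (suc t) (s≤s z≤n) (ℕ.≤-pred lt)))
      low : ∀ t → t ≤ suc m → Low (suc h) (g t)
      low t t≤ with position t t≤
      ... | inj₁ refl = subst (Low (suc h)) (sym g₀) (top (u-level (i + e)))
      ... | inj₂ (inj₁ refl) = subst (Low (suc h)) (sym gₘ) (top (u-level i))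
      ... | inj₂ (inj₂ l) = low-suc l
      disjoint : ∀ s t → s ≤ e → t ≤ suc m → c (i + s) ≢ g t
      disjoint s t _ t≤ eq = low≢c (low t t≤) (i + s) (sym eq)
      cross : ∀ s t → s ≤ e → t ≤ suc m → Adj G (c (i + s)) (g t) → (s ≡ e × t ≡ 0) ⊎ (s ≡ 0 × t ≡ suc m)
      cross s t s≤e t≤ a with position t t≤
      ... | inj₂ (inj₂ l) = ⊥-elim (low-nonadjacent l (level-c (i + s)) (Adj-sym G a))
      ... | inj₁ refl with ℕ.m≤n⇒m<n∨m≡n s≤e
      ...   | inj₂ s≡e = inj₁ (s≡e , refl)
      ...   | inj₁ s<e = ⊥-elim (oneNeighbour (top (u-level (i + e))) (i + s) (i + e) (ℕ.+-monoʳ-< i s<e)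
                (ℕ.<-≤-trans (ℕ.+-monoʳ-< i e≤K) (ℕ.+-monoˡ-≤ K (ℕ.m≤m+n i s)))
                (subst (λ z → Adj G z (c (i + s))) g₀ (Adj-sym G a)) (Adj-sym G (u-adj (i + e))))
      cross zero t s≤e t≤ a | inj₂ (inj₁ refl) = inj₂ (refl , refl)
      cross (suc s) t s≤e t≤ a | inj₂ (inj₁ refl) =
        ⊥-elim (oneNeighbour (top (u-level i)) i (i + suc s) (ℕ.m<m+n i (s≤s z≤n)) (ℕ.+-monoʳ-< i (ℕ.≤-<-trans s≤e e≤K))
                (Adj-sym G (u-adj i)) (subst (λ z → Adj G z (c (i + suc s))) gₘ (Adj-sym G a)))
      αβ : Adj G (c (i + e)) (g 0)
      αβ = subst (Adj G (c (i + e))) (sym g₀) (u-adj (i + e))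
      βα : Adj G (g (suc m)) (c (i + 0))
      βα = subst₂ (λ x s → Adj G x (c s)) (sym gₘ) (sym (ℕ.+-identityʳ i)) (Adj-sym G (u-adj i))

  Ends : (Fin n → Set) → Fin n → Fin n → Fin n → Set
  Ends Y x y z = Y z ⊎ (z ≡ x ⊎ z ≡ y)

  private
    pathLength : ∀ i d → 2 ≤ d → d ≤ ℓ → ∀ m g → g 0 ≡ u i → g (suc m) ≡ u (i + d) →
      InducedPath G (suc m) g → (∀ s → 1 ≤ s → s ≤ m → Low h (g s)) → d + suc m + 1 ≡ 2 * ℓ
    pathLength i d 2≤d d≤ℓ m g g₀ gₘ P interior = opposite (≤⇒∃+ (ℕ.<⇒≤ (ℓ<K ℓ 0 d d≤ℓ)))
      where
      -- This arc runs from `i` to `i + d`, so the path is reversed to lead back to `u i`. The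
      -- opposite arc runs from `i + d` to `i + K`, where periodicity gives `u i` again.
      shorter : K ≤ suc d + suc (suc m) × (Odd (suc d + suc (suc m)) → suc d + suc (suc m) ≡ K)
      shorter = closeUp i d (ℕ.≤-trans (s≤s z≤n) 2≤d) (arc-room′ ℓ d 2≤ℓ d≤ℓ) m (λ s → g (suc m ∸ s))
        gₘ (trans (cong g (ℕ.n∸n≡0 m)) g₀) (reversePath G P)
        (λ s 1≤s s≤m → interior (suc m ∸ s) (ℕ.m<n⇒0<n∸m (s≤s s≤m)) (ℕ.∸-monoʳ-≤ (suc m) 1≤s))
      opposite : (∃ λ f → K ≡ d + f) → d + suc m + 1 ≡ 2 * ℓ
      opposite (f , eq) = link-length ℓ d f m (sym eq) d≤ℓ shorter
        (closeUp (i + d) f (1≤f-arith ℓ d f (sym eq) d≤ℓ) (arc-room ℓ d f (sym eq) 2≤d) m g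
          (trans g₀ (sym (trans (cong u (trans (ℕ.+-assoc i d f) (cong (i +_) (sym eq)))) (u-periodic i)))) gₘ P interior)

  -- The two arcs of the cycle between positions i and i + d have lengths of different parity, so the path
  -- from u i to u (i + d) closes up with one of them to an induced odd cycle, which must have length 2ℓ + 1.
  abstract
    link : ∀ i d → 2 ≤ d → d ≤ ℓ → {Y : Fin n → Set} → (∀ x → Dec (Y x)) → (∀ {x} → Y x → Low h x) →
      ∀ {k} → Wk (Within G (Ends Y (u i) (u (i + d)))) k (u i) (u (i + d)) →
      ∃ λ m → d + suc m + 1 ≡ 2 * ℓ × suc m ≤ k × ∃ λ g → g 0 ≡ u i × g (suc m) ≡ u (i + d) ×
        InducedPath G (suc m) g × (∀ s → 1 ≤ s → s ≤ m → Y (g s))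
    link i d 2≤d d≤ℓ {Y} Y? Y⊆ w
      with geodesicWithin G {Ends Y (u i) (u (i + d))} (λ x → Y? x ⊎-dec ((x ≟ u i) ⊎-dec (x ≟ u (i + d))))
             (u-distinct i (i + d) (ℕ.m<m+n i (ℕ.≤-trans (s≤s z≤n) 2≤d)) (ℓ<K ℓ i d d≤ℓ)) w
    ... | m , m≤k , g , g₀ , gₘ , P , inside = m , length , m≤k , g , g₀ , gₘ , P , interior
      where
      module P = InducedPath P
      interior : ∀ s → 1 ≤ s → s ≤ m → Y (g s)
      interior s 1≤s s≤m with inside s (ℕ.m≤n⇒m≤1+n s≤m)
      ... | inj₁ y = y
      ... | inj₂ (inj₁ eq) = ⊥-elim (P.inj 0 s 1≤s (ℕ.m≤n⇒m≤1+n s≤m) (trans g₀ (sym eq)))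
      ... | inj₂ (inj₂ eq) = ⊥-elim (P.inj s (suc m) (s≤s s≤m) ℕ.≤-refl (trans eq (sym gₘ)))
      length : d + suc m + 1 ≡ 2 * ℓ
      length = pathLength i d 2≤d d≤ℓ m g g₀ gₘ P λ s 1≤s s≤m → Y⊆ (interior s 1≤s s≤m)

  Linked : (Fin n → Set) → Fin n → Fin n → ℕ → ℕ → Set
  Linked Y x y d k = ∃ λ m → d + suc m + 1 ≡ 2 * ℓ × suc m ≤ k × ∃ λ g → g 0 ≡ x × g (suc m) ≡ y ×
    InducedPath G (suc m) g × (∀ s → 1 ≤ s → s ≤ m → Y (g s))

  -- The property in `link` as one of two vertices rather than two indices, so that it can be
  -- reversed and moved by a period.
  Opposite : Fin n → Fin n → ℕ → Set₁
  Opposite x y d = ∀ {Y : Fin n → Set} → (∀ x → Dec (Y x)) → (∀ {x} → Y x → Low h x) →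
    ∀ {k} → Wk (Within G (Ends Y x y)) k x y → Linked Y x y d k

  linkTo : ∀ i d {x y} → 2 ≤ d → d ≤ ℓ → u i ≡ x → u (i + d) ≡ y → Opposite x y d
  linkTo i d 2≤d d≤ℓ refl refl = link i d 2≤d d≤ℓ

  opposite-sym : ∀ {x y d} → Opposite x y d → Opposite y x d
  opposite-sym {x} {y} opp {Y} Y? Y⊆ w with opp Y? Y⊆ (mapWk swap-ends (reverse (within-sym G (Ends Y y x)) w))
    where
    swap : ∀ {z} → Ends Y y x z → Ends Y x y z
    swap (inj₁ p) = inj₁ p
    swap (inj₂ (inj₁ p)) = inj₂ (inj₂ p)
    swap (inj₂ (inj₂ p)) = inj₂ (inj₁ p)
    swap-ends : ∀ {p q} → Within G (Ends Y y x) p q → Within G (Ends Y x y) p q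
    swap-ends (a , p , q) = a , swap p , swap q
  ... | m , eq , m≤k , g , g₀ , gₘ , P , interior =
    m , eq , m≤k , (λ s → g (suc m ∸ s)) , gₘ , trans (cong g (ℕ.n∸n≡0 m)) g₀ , reversePath G P ,
    λ s 1≤s s≤m → interior (suc m ∸ s) (ℕ.m<n⇒0<n∸m (s≤s s≤m)) (ℕ.∸-monoʳ-≤ (suc m) 1≤s)

  module _ (connected : InducedConnected G S) where

    connectLow : ∀ i j → ∃ λ k → Wk (Within G (Ends (Low h) (u i) (u j))) k (u i) (u j)
    connectLow i j = connect connected (λ z∈S → inj₁ (0 , s≤s z≤n , level-0 z∈S)) (u-level i) (u-level j)
      (inj₂ (inj₁ refl)) (inj₂ (inj₂ refl)) (λ k< p → inj₁ (_ , k< , p)) (λ k< p → inj₁ (_ , k< , p))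

    -- All u s and u (s + 2) are adjacent, so the u s form a 5-cycle in level h + 1.
    pentagon : ℓ ≡ 2 → ¬ InducedBipartite G (Level G S (suc h))
    -- Colours alternate along `u 0`, `u 2`, `u 4`, `u 6`, `u 8`, `u 10`, so `u 8` has the colour of
    -- `u 0`, which is also `u 10`.
    pentagon ℓ≡2 (f , f-ok) = differ 8 (trans (sym (same 4)) (trans (sym (same 0)) (cong f (sym u₁₀≡u₀))))
      where
      2≤ : 2 ≤ ℓ
      2≤ = ℕ.≤-reflexive (sym ℓ≡2)
      adjacent : ∀ s → Adj G (u s) (u (s + 2))
      adjacent s with link s 2 ℕ.≤-refl 2≤ (low? h) (λ l → l) (proj₂ (connectLow s (s + 2)))
      ... | m , eq , _ , g , g₀ , gₘ , P , _ with link₂ ℓ m ℓ≡2 eq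
      ...   | refl = subst₂ (Adj G) g₀ gₘ (InducedPath.step P 0 ℕ.≤-refl)
      differ : ∀ s → f (u s) ≢ f (u (s + 2))
      differ s = f-ok _ _ (u-level s) (u-level (s + 2)) (adjacent s)
      same : ∀ s → f (u s) ≡ f (u (s + 2 + 2))
      same s = bool-≢ (differ s) (differ (s + 2))
      period₅ : ∀ s → u (s + 5) ≡ u s
      period₅ s = subst (λ z → u (s + (2 * z + 1)) ≡ u s) ℓ≡2 (u-periodic s)
      u₁₀≡u₀ : u 10 ≡ u 0
      u₁₀≡u₀ = trans (period₅ 5) (period₅ 0)

    -- Cycles of length 7: the case ℓ = 3

    module Heptagon (ℓ≡3 : ℓ ≡ 3) where

      period₇ : ∀ s → u (s + 7) ≡ u s
      period₇ s = subst (λ z → u (s + (2 * z + 1)) ≡ u s) ℓ≡3 (u-periodic s)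

      low≢u : ∀ {x} → Low h x → ∀ s → x ≢ u s
      low≢u l s refl = low-apart l (u-level s)

      u-apart : ∀ j → u j ≢ u (j + 3)
      u-apart j = u-distinct j (j + 3) (ℕ.m<m+n j (s≤s z≤n)) (ℓ<K ℓ j 3 (ℕ.≤-reflexive (sym ℓ≡3)))

      -- Modulo 7, `j + 5` is two steps from both `j` and `j + 3`, so links to `u (j + 5)` from
      -- these have 3 edges, while the link from `u j` to `u (j + 3)` has 2.
      Claw : ℕ → Set
      Claw j = ∃ λ w → ∃ λ y → Low h w × Low h y × Adj G (u j) w × Adj G (u (j + 3)) w × Adj G w y × Adj G y (u (j + 5))

      -- A common lower neighbour w of u j and u (j + 3) lies at distance 2 from u (j + 5): on an induced path
      -- from w to u (j + 5), both u j and u (j + 3) are adjacent to the third vertex from the end.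
      claw : ∀ j → Claw j
      claw j with link j 3 (s≤s (s≤s z≤n)) (ℕ.≤-reflexive (sym ℓ≡3)) (low? h) (λ l → l) (proj₂ (connectLow j (j + 3)))
      ... | m , eq , _ , q , q₀ , qₘ , Q , Q-low with link₃,₃ ℓ m ℓ≡3 eq
      ...   | refl = fromCentre (q 1) (Q-low 1 ℕ.≤-refl ℕ.≤-refl)
                       (subst (λ z → Adj G z (q 1)) q₀ (InducedPath.step Q 0 (s≤s z≤n)))
                       (Adj-sym G (subst (Adj G (q 1)) qₘ (InducedPath.step Q 1 ℕ.≤-refl)))
        where
        t : Fin n
        t = u (j + 5)
        Z : Fin n → Set
        Z x = Low h x ⊎ x ≡ t
        module Along (w : Fin n) (w-low : Low h w) (aw : Adj G (u j) w) (bw : Adj G (u (j + 3)) w)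
          (k : ℕ) (g : ℕ → Fin n) (g₀ : g 0 ≡ w) (gₖ : g (suc k) ≡ t) (P : InducedPath G (suc k) g)
          (inside : ∀ s → s ≤ suc k → Z (g s)) where
          module P = InducedPath P
          low : ∀ s → s < suc k → Low h (g s)
          low s s<k with inside s (ℕ.<⇒≤ s<k)
          ... | inj₁ l  = l
          ... | inj₂ eq = ⊥-elim (P.inj s (suc k) s<k ℕ.≤-refl (trans eq (sym gₖ)))
          -- Admitting only vertices of the path forces a link from a neighbour of `w` to `t` to run
          -- along it.
          Y : Fin n → Set
          Y x = ∃ λ s → s < suc k × x ≡ g s
          Y⊆ : ∀ {x} → Y x → Low h x
          Y⊆ (s , s<k , refl) = low s s<k
          walk : ∀ v → Adj G v w → Wk (Within G (Ends Y v t)) (suc (suc k)) v t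
          walk v vw = (subst (Adj G v) (sym g₀) vw , inj₂ (inj₁ refl) , inj₁ (0 , s≤s z≤n , refl))
            ◃ subst (Wk _ (suc k) (g 0)) gₖ (segment g 0 (suc k) λ s _ s< → P.step s s< , in-Z s (ℕ.<⇒≤ s<) , in-Z (suc s) s<)
            where
            in-Z : ∀ s → s ≤ suc k → Ends Y v t (g s)
            in-Z s s≤ with ℕ.m≤n⇒m<n∨m≡n s≤
            ... | inj₁ s< = inj₁ (s , s< , refl)
            ... | inj₂ refl = inj₂ (inj₂ gₖ)
          -- The link is `v`, `r 1`, `r 2`, `t`. As `g` is induced, `r 2` is its last vertex before
          -- `t`, and `r 1` the one before that.
          third : ∀ v → Adj G v w → Opposite v t 2 → ∃ λ s → k ≡ suc s × Adj G v (g s)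
          third v vw opp with opp (λ x → ℕ.anyUpTo? (λ s → x ≟ g s) (suc k)) Y⊆ (walk v vw)
          ... | m , eq , _ , r , r₀ , rₘ , R , R-Y with link₃,₂ ℓ m ℓ≡3 eq
          ...   | refl with R-Y 1 ℕ.≤-refl (s≤s z≤n) | R-Y 2 (s≤s z≤n) ℕ.≤-refl
          ...     | s₁ , s₁< , eq₁ | s₂ , s₂< , eq₂ with
            ℕ.suc-injective (P.chordless s₂ (suc k) s₂< ℕ.≤-refl
              (subst₂ (Adj G) eq₂ (trans rₘ (sym gₖ)) (InducedPath.step R 2 ℕ.≤-refl)))
          ...       | refl with ℕ.m≤n⇒m<n∨m≡n (ℕ.≤-pred s₁<)
          ...         | inj₁ s₁<k = s₁ , P.chordless s₁ k s₁<k (ℕ.n≤1+n k)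
                          (subst₂ (Adj G) eq₁ eq₂ (InducedPath.step R 1 (s≤s (s≤s z≤n))))
                        , subst₂ (Adj G) r₀ eq₁ (InducedPath.step R 0 (s≤s z≤n))
          ...         | inj₂ refl = ⊥-elim (InducedPath.inj R 1 2 ℕ.≤-refl (s≤s (s≤s z≤n)) (trans eq₁ (sym eq₂)))
          result : Claw j
          result with third (u j) aw (opposite-sym {d = 2} (linkTo (j + 5) 2 ℕ.≤-refl 2≤ℓ refl
                           (trans (cong u (ℕ.+-assoc j 5 2)) (period₇ j))))
                    | third (u (j + 3)) bw (linkTo (j + 3) 2 ℕ.≤-refl 2≤ℓ refl (cong u (ℕ.+-assoc j 3 2)))
          ... | zero , refl , _ | _ = w , g 1 , w-low , low 1 ℕ.≤-refl , aw , bw ,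
                  subst (λ z → Adj G z (g 1)) g₀ (P.step 0 (s≤s z≤n)) , subst (Adj G (g 1)) gₖ (P.step 1 ℕ.≤-refl)
          -- Here `g (suc s)` and `w` are two common neighbours of `u j` and `u (j + 3)`, which
          -- gives a 4-cycle.
          ... | suc s , refl , ax | .(suc s) , refl , bx =
            ⊥-elim (too-short ℓ 3 ℓ≡3 (s≤s (s≤s (s≤s z≤n))) (detour aw
              (otherʳ G ax (λ eq → Adj⇒≢ G ax (sym eq)) x≢w ◃ otherˡ G (Adj-sym G bx) (λ eq → Adj⇒≢ G ax (sym eq)) x≢w
                ◃ otherˡ G bw (λ eq → u-apart j (sym eq)) (Adj⇒≢ G bw) ◃ nil)))
            where
            x≢w : g (suc s) ≢ w
            x≢w eq = P.inj 0 (suc s) (s≤s z≤n) (ℕ.m≤n⇒m≤1+n (ℕ.n≤1+n (suc s))) (trans g₀ (sym eq))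
        fromCentre : ∀ w → Low h w → Adj G (u j) w → Adj G (u (j + 3)) w → Claw j
        fromCentre w w-low@(i , i≤h , w-level) aw bw
          with connect {Y = Z} connected (λ z∈S → inj₁ (0 , s≤s z≤n , level-0 z∈S)) w-level (u-level (j + 5)) (inj₁ w-low) (inj₂ refl)
                 (λ k< p → inj₁ (_ , ℕ.<-trans k< i≤h , p)) (λ k< p → inj₁ (_ , k< , p))
        ... | _ , walk with geodesicWithin G (λ x → low? h x ⊎-dec (x ≟ t)) (low≢u w-low (j + 5)) walk
        ...   | k , _ , g , g₀ , gₖ , P , inside = Along.result w w-low aw bw k g g₀ gₖ P inside

      -- Since `u 9` is `u 2`, the claws at 4 and 2 form the closed walk `w`, `u 7`, `y′`, `w′`,
      -- `u 2`, `y` of length 6, below the girth 7 if `w` differs from `y′`. If they coincide,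
      -- `u 4`, `w`, `w′`, `u 5` is too short a walk between neighbouring parents.
      contradiction : ⊥
      contradiction with claw 4 | claw 2
      ... | w , y , w-low , y-low , u₄w , u₇w , wy , yu₉ | w′ , y′ , w′-low , y′-low , u₂w′ , u₅w′ , w′y′ , y′u₇
        with w ≟ y′
      ... | yes refl = too-short ℓ 5 ℓ≡3 ℕ.≤-refl (neighbouringParents 4
              ((u₄w , top (u-level 4) , low-suc w-low) ◃ (Adj-sym G w′y′ , low-suc w-low , low-suc w′-low)
                ◃ (Adj-sym G u₅w′ , low-suc w′-low , top (u-level 5)) ◃ nil))
      ... | no w≢y′ = too-short ℓ 5 ℓ≡3 ℕ.≤-refl (detour u₇w
              (otherʳ G (Adj-sym G y′u₇) (low≢u y′-low 7) (λ eq → w≢y′ (sym eq))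
                ◃ otherˡ G (Adj-sym G w′y′) (low≢u y′-low 7) (λ eq → w≢y′ (sym eq))
                ◃ otherʳ G (Adj-sym G u₂w′) u₂≢u₇ (λ eq → low≢u w-low 2 (sym eq))
                ◃ otherʳ G (subst (λ z → Adj G z y) (period₇ 2) (Adj-sym G yu₉)) (low≢u y-low 7) (λ eq → Adj⇒≢ G wy (sym eq))
                ◃ otherˡ G (Adj-sym G wy) (low≢u y-low 7) (λ eq → Adj⇒≢ G wy (sym eq)) ◃ nil))
        where
        u₂≢u₇ : u 2 ≢ u 7
        u₂≢u₇ = u-distinct 2 7 (s≤s (s≤s (s≤s z≤n))) (subst (λ z → 7 < 2 + (2 * z + 1)) (sym ℓ≡3) (ℕ.m≤n+m 8 1))

    -- Links through a common first vertex: the case ℓ ≥ 4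

    module _ (4≤ℓ : 4 ≤ ℓ) (1≤h : 1 ≤ h) where

      private
        centre : ∃ λ a → Adj G (u 0) a × Level G S h a
        centre = parent (u-level 0)
        a : Fin n
        a = proj₁ centre
        u₀a : Adj G (u 0) a
        u₀a = proj₁ (proj₂ centre)
        Y : Fin n → Set
        Y x = Low h x × (¬ Adj G (u 0) x ⊎ x ≡ a)
        Y? : ∀ x → Dec (Y x)
        Y? x = low? h x ×-dec (¬? (Adj? G (u 0) x) ⊎-dec (x ≟ a))
        Y-a : ∀ {x} → Y x → Adj G (u 0) x → x ≡ a
        Y-a (_ , inj₁ ¬adj) adj′ = ⊥-elim (¬adj adj′)
        Y-a (_ , inj₂ eq)   _    = eq
        below : ∀ {k z} → k < h → Level G S k z → Y z
        below k<h p = (_ , ℕ.m<n⇒m<1+n k<h , p) , inj₁ λ u₀z → ℕ.<⇒≱ (s≤s k<h) (level-step p (Adj-sym G u₀z) (u-level 0))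

      -- Y drops all lower neighbours of u 0 except a. They all lie in level h, so a and the lower neighbours
      -- of u t still descend to S inside Y, and every path from u 0 through Y starts with a.
      throughCentre : ∀ t → Opposite (u 0) (u t) ℓ →
        ∃ λ m → ℓ + suc m + 1 ≡ 2 * ℓ × Wk (Within G (Low (suc h))) m a (u t)
      throughCentre t opp with parent (u-level t)
      ... | b , tb , b-level with Adj? G (u 0) b
      -- A common lower neighbour would give a link of at most 2 edges, but the link has
      -- `ℓ - 1 ≥ 3`.
      ...   | yes u₀b with opp {Low h} (low? h) (λ l → l)
                ((u₀b , inj₂ (inj₁ refl) , inj₁ (top b-level)) ◃ (Adj-sym G tb , inj₁ (top b-level) , inj₂ (inj₂ refl)) ◃ nil)
      ...     | m , eq , m≤2 , _ = ⊥-elim (ℕ.<⇒≱ (close-parents ℓ m 4≤ℓ eq m≤2) z≤n)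
      throughCentre t opp | b , tb , b-level | no ¬u₀b
        with connect {Y = Ends Y (u 0) (u t)} connected (λ z∈S → inj₁ (below 1≤h (level-0 z∈S)))
               (proj₂ (proj₂ centre)) b-level (inj₁ (top (proj₂ (proj₂ centre)) , inj₂ refl)) (inj₁ (top b-level , inj₁ ¬u₀b))
               (λ k< p → inj₁ (below k< p)) (λ k< p → inj₁ (below k< p))
      ... | _ , w with opp Y? proj₁ ((u₀a , inj₂ (inj₁ refl) , inj₁ (top (proj₂ (proj₂ centre)) , inj₂ refl))
                    ◃ snoc w (Adj-sym G tb , inj₁ (top b-level , inj₁ ¬u₀b) , inj₂ (inj₂ refl)))
      ...   | m , eq , _ , g , g₀ , gₘ , P , interior = m , eq ,
              subst₂ (Wk _ m) (Y-a (interior 1 ℕ.≤-refl 1≤m) (subst (λ z → Adj G z (g 1)) g₀ (InducedPath.step P 0 (s≤s z≤n)))) gₘ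
                (segment g 1 m λ s 1≤s s< → InducedPath.step P s s< , low s 1≤s (ℕ.<⇒≤ s<) , low (suc s) (s≤s z≤n) s<)
        where
        1≤m : 1 ≤ m
        1≤m = 1≤link ℓ m 4≤ℓ eq
        low : ∀ s → 1 ≤ s → s ≤ suc m → Low (suc h) (g s)
        low s 1≤s s≤ with ℕ.m≤n⇒m<n∨m≡n s≤
        ... | inj₁ s≤m = low-suc (proj₁ (interior s 1≤s (ℕ.≤-pred s≤m)))
        ... | inj₂ refl = subst (Low (suc h)) (sym gₘ) (top (u-level t))

      -- Both `u ℓ` and `u (suc ℓ)` are `ℓ` steps from `u 0` around the cycle. From `a` each link
      -- has `ℓ - 2` edges left, too few in total for neighbouring parents.
      longCycle : ⊥
      longCycle with throughCentre ℓ (linkTo 0 ℓ 2≤ℓ ℕ.≤-refl refl refl)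
                   | throughCentre (suc ℓ) (opposite-sym {d = ℓ} (linkTo (suc ℓ) ℓ 2≤ℓ ℕ.≤-refl refl
                       (trans (cong u (wrap ℓ)) (u-periodic 0))))
      ... | m , eq , w | m′ , eq′ , w′ = ℕ.<⇒≱ (two-links ℓ m m′ eq eq′
              (neighbouringParents ℓ (reverse (within-sym G (Low (suc h))) w ++ w′))) z≤n

-- Arithmetic, encoding of colours and unordered pairs

piece-arith : ∀ e f t s → t ≤ suc e → 1 ≤ f → suc t ≡ s + (suc e + suc f) → 1 ≤ 0
piece-arith e f t s p q eq = linear s (p ⊕ q ⊕ ℕ.≤-reflexive (sym eq)) (solve (e ∷ f ∷ t ∷ s ∷ []))

pieces-sum : ∀ e f → 2 + (suc e + suc f) ≡ suc (suc e) + suc (suc f)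
pieces-sum e f = solve (e ∷ f ∷ [])

1+i+i : ∀ i → 1 + i * 2 ≡ i + suc i
1+i+i i = solve (i ∷ [])

stable-arith : ∀ ℓ i q → 2 ≤ ℓ → i ≤ q → q * 2 ≤ ℓ → 2 * ℓ + 1 ≤ i + suc i → 1 ≤ 0
stable-arith ℓ i q p₁ p₂ p₃ p₄ = linear 1 (p₁ ⊕ p₂ ⊕ p₂ ⊕ p₃ ⊕ p₄) (solve (ℓ ∷ i ∷ q ∷ []))

-- Adjacent vertices lie on levels at most one apart; equal parity then puts them on the same level.
parity-close : ∀ i j → i ≤ suc j → j ≤ suc i → parity i ≡ parity j → i ≡ j
parity-close zero          zero          _       _       _  = refl
parity-close zero          (suc zero)    _       _       ()
parity-close zero          (suc (suc j)) _       (s≤s ()) _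
parity-close (suc zero)    zero          _       _       ()
parity-close (suc (suc i)) zero          (s≤s ()) _      _
parity-close (suc i)       (suc j)       (s≤s p) (s≤s q) eq =
  cong suc (parity-close i j p q (Bool.not-injective eq))

pair : Bool × Bool → Fin 4
pair (false , false) = fzero
pair (false , true)  = fsuc fzero
pair (true  , false) = fsuc (fsuc fzero)
pair (true  , true)  = fsuc (fsuc (fsuc fzero))

unpair : Fin 4 → Bool × Bool
unpair fzero                      = false , false
unpair (fsuc fzero)               = false , true
unpair (fsuc (fsuc fzero))        = true , false
unpair (fsuc (fsuc (fsuc fzero))) = true , true

unpair-pair : ∀ p → unpair (pair p) ≡ p
unpair-pair (false , false) = refl
unpair-pair (false , true)  = refl
unpair-pair (true  , false) = refl
unpair-pair (true  , true)  = refl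

samePair-compare : ∀ {n} {p q p′ q′ u v : Fin n} → SamePair p q u v → SamePair p′ q′ u v →
  (p ≡ p′ × q ≡ q′) ⊎ (p ≡ q′ × q ≡ p′)
samePair-compare (inj₁ (refl , refl)) (inj₁ (refl , refl)) = inj₁ (refl , refl)
samePair-compare (inj₁ (refl , refl)) (inj₂ (refl , refl)) = inj₂ (refl , refl)
samePair-compare (inj₂ (refl , refl)) (inj₁ (refl , refl)) = inj₂ (refl , refl)
samePair-compare (inj₂ (refl , refl)) (inj₂ (refl , refl)) = inj₁ (refl , refl)

samePair-swap : ∀ {n} {p q u v : Fin n} → SamePair p q u v → SamePair q p u v
samePair-swap (inj₁ (p , q)) = inj₂ (q , p)
samePair-swap (inj₂ (p , q)) = inj₁ (q , p)

samePair-adj : ∀ {n} (G : Graph n) {p q u v : Fin n} → SamePair p q u v → Adj G u v → Adj G p q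
samePair-adj G (inj₁ (refl , refl)) uv = uv
samePair-adj G (inj₂ (refl , refl)) uv = Adj-sym G uv

-- The three claims

module _ {n : ℕ} (G : Graph n) (ℓ : ℕ) (2≤ℓ : 2 ≤ ℓ)
  (girth : ∀ k → k < 2 * ℓ + 1 → ¬ HasCycleOfLength G k)
  (noHole : ∀ k (c : Fin k → Fin n) → 2 * ℓ + 3 ≤ k → ¬ IsOddHole G k c) where

  open Girth G ℓ 2≤ℓ girth

  abstract
    -- A shortest odd closed walk in `Y` is no loop, hence an induced odd cycle, and its length is
    -- forced.
    oddCycleWithin : ∀ {Y : Fin n → Set} → (∀ x → Dec (Y x)) → ∀ {m x} → Odd m → Wk (Within G Y) m x x →
      2 * ℓ + 1 ≤ m × ∃ λ c → Cyclic G (2 * ℓ + 1) c × (∀ s → Y (c s))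
    oddCycleWithin {Y} Y? odd-m w
      with shortestOddClosed (within? G Y Y?) (λ {x} {y} → within-sym G Y {x} {y}) odd-m w
    ... | k , k≤m , odd-k , g , gₖ , step , inj , chord with odd⇒ k odd-k
    ...   | zero , refl = ⊥-elim (Adj⇒≢ G (proj₁ (step 0 ℕ.≤-refl)) (sym gₖ))
    ...   | suc j , refl = ℕ.≤-trans (proj₁ len) k≤m , c , subst (λ z → Cyclic G z c) (proj₂ len odd-k) (cyclic G C) ,
              λ s → proj₁ (proj₂ (step _ (Fin.toℕ<n (fromℕ< (m%n<n s k)))))
      where
      k≡ : ∀ s → suc s ≡ k → Adj G (g s) (g 0)
      k≡ s refl = subst (Adj G (g s)) gₖ (proj₁ (step s ℕ.≤-refl))
      inside : ∀ s → s < k → Y (g s)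
      inside s s<k = proj₁ (proj₂ (step s s<k))
      C : IsInducedCycle G k (g ∘ toℕ)
      C = inducedCycle G g
            (cycle G g (s≤s (s≤s (s≤s z≤n))) (λ s s< → proj₁ (step s (ℕ.<-trans (ℕ.n<1+n s) s<))) k≡ inj)
            (λ s t s<t t<k a → chord s t s<t t<k (a , inside s (ℕ.<-trans s<t t<k) , inside t t<k))
      len : 2 * ℓ + 1 ≤ k × (Odd k → k ≡ 2 * ℓ + 1)
      len = inducedLength noHole C
      c : ℕ → Fin n
      c s = g (toℕ (fromℕ< (m%n<n s k)))

  -- Bipartiteness of all levels

  module _ (S : Subset n) (connected : InducedConnected G S)
           (base : ∀ i → 1 ≤ i → i ≤ ℓ / 2 → InducedBipartite G (Level G S i)) where

    open Levels G S

    private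
      module OnLevel (h : ℕ) (c : ℕ → Fin n) (C : Cyclic G (2 * ℓ + 1) c)
                     (level-c : ∀ s → Level G S (suc (suc h)) (c s)) =
        Layer G ℓ 2≤ℓ girth noHole S h c C level-c (λ s → parentOf (suc h) (c s))
          (λ s → proj₁ (parentOf-spec (level-c s))) (λ s → proj₂ (parentOf-spec (level-c s)))
          (λ s → cong (parentOf (suc h)) (Cyclic.periodic C s))

      noOddCycle : ∀ h → InducedBipartite G (Level G S (suc h)) → (4 ≤ ℓ → 1 ≤ h) →
        ∀ c → Cyclic G (2 * ℓ + 1) c → ¬ (∀ s → Level G S (suc (suc h)) (c s))
      noOddCycle h below 1≤h c C level-c with ℓ ℕ.≟ 2 | ℓ ℕ.≟ 3
      ... | yes ℓ≡2 | _       = OnLevel.pentagon h c C level-c connected ℓ≡2 below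
      ... | no _    | yes ℓ≡3 = OnLevel.Heptagon.contradiction h c C level-c connected ℓ≡3
      ... | no ℓ≢2  | no ℓ≢3  = OnLevel.longCycle h c C level-c connected 4≤ℓ (1≤h 4≤ℓ)
        where
        4≤ℓ : 4 ≤ ℓ
        4≤ℓ = ℕ.≤∧≢⇒< (ℕ.≤∧≢⇒< 2≤ℓ (λ eq → ℓ≢2 (sym eq))) (λ eq → ℓ≢3 (sym eq))

      above : ∀ h → InducedBipartite G (Level G S (suc h)) → (4 ≤ ℓ → 1 ≤ h) →
        InducedBipartite G (Level G S (suc (suc h)))
      above h below 1≤h
        with bipartite⊎oddClosed (within? G (Level G S (suc (suc h))) (level? (suc (suc h))))
               (λ {x} {y} → within-sym G (Level G S (suc (suc h))) {x} {y})
      ... | inj₁ (f , ok) = f , λ x y p q xy → ok x y (xy , p , q)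
      ... | inj₂ (m , x , odd , w) with oddCycleWithin (level? (suc (suc h))) odd w
      ...   | _ , c , C , level-c = ⊥-elim (noOddCycle h below 1≤h c C level-c)

    -- For `4 ≤ ℓ` the hypothesis covers levels 1 and 2, so `longCycle` is applied from level 3 on,
    -- where `1 ≤ h`.
    bipartiteLevel : ∀ i → InducedBipartite G (Level G S (suc i))
    bipartiteLevel zero    = base 1 ℕ.≤-refl (/-monoˡ-≤ 2 2≤ℓ)
    bipartiteLevel (suc zero) with 4 ≤? ℓ
    ... | yes 4≤ℓ = base 2 (s≤s z≤n) (/-monoˡ-≤ 2 4≤ℓ)
    ... | no  4≰ℓ = above 0 (bipartiteLevel 0) (λ 4≤ℓ → ⊥-elim (4≰ℓ 4≤ℓ))
    bipartiteLevel (suc (suc i)) = above (suc i) (bipartiteLevel (suc i)) (λ _ → s≤s z≤n)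

  -- Four colours from the levels of a single vertex

  module _ (r : Fin n) where

    open Levels G ⁅ r ⁆

    singleton-connected : InducedConnected G ⁅ r ⁆
    singleton-connected = (r , x∈⁅x⁆ r) , λ x y x∈ y∈ →
      0 , ((λ _ → x) , refl , trans (x∈⁅y⁆⇒x≡y r x∈) (sym (x∈⁅y⁆⇒x≡y r y∈)) , λ ()) , λ _ → x∈

    private
      near-root : ∀ {i x} → Level G ⁅ r ⁆ i x → Wk (Adj G) i x r
      near-root {i} {x} p with level⇒near p
      ... | y , y∈ , w = subst (Wk (Adj G) i x) (x∈⁅y⁆⇒x≡y r y∈) w

      everywhere : ∀ {x y} → Adj G x y → Within G (λ _ → ⊤) x y
      everywhere xy = xy , tt , tt

      -- An edge inside the level and walks from its ends to the root form an odd closed walk of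
      -- length `2 * i + 1 ≤ ℓ + 1`, below the girth. The constant colouring therefore suffices.
      stable : ∀ i → 1 ≤ i → i ≤ ℓ / 2 → InducedBipartite G (Level G ⁅ r ⁆ i)
      stable i _ i≤ = (λ _ → false) , λ x y p q xy → ⊥-elim (ℕ.<⇒≱ (stable-arith ℓ i (ℓ / 2) 2≤ℓ i≤ (m/n*n≤m ℓ 2)
        (proj₁ (oddCycleWithin (λ _ → yes tt) (subst Odd (1+i+i i) (1+2j-odd i))
          (mapWk everywhere (reverse (Adj-sym G) (near-root p) ++ (xy ◃ near-root q)))))) z≤n)

    side : ℕ → Fin n → Bool
    side zero    x = false
    side (suc i) x = proj₁ (bipartiteLevel ⁅ r ⁆ singleton-connected stable i) x

    separated : ∀ {i j x y} → Adj G x y → Level G ⁅ r ⁆ i x → Level G ⁅ r ⁆ j y →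
      parity i ≡ parity j → side i x ≢ side j y
    separated {i} {j} xy p q eq with parity-close i j (level-step q (Adj-sym G xy) p) (level-step p xy q) eq
    separated {zero}  xy p q _ | refl = λ _ → Adj⇒≢ G xy (trans (x∈⁅y⁆⇒x≡y r (∈-0 p)) (sym (x∈⁅y⁆⇒x≡y r (∈-0 q))))
    separated {suc i} xy p q _ | refl = proj₂ (bipartiteLevel ⁅ r ⁆ singleton-connected stable i) _ _ p q xy

  -- Each component is layered from its representative. A colour records the parity of the level and
  -- the side within it; ends of an edge with equal parity share a level, hence differ in side.
  fourColourable : ChromaticAtMost G 4
  fourColourable with components (Adj? G) (Adj-sym G)
  ... | rep , walks , same = (λ x → pair (parity (depth x) , side (rep x) (depth x) x)) , proper
    where
    level : ∀ x → ∃ λ j → j ≤ proj₁ (walks x) × Level G ⁅ rep x ⁆ j x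
    level x = Levels.near⇒level G ⁅ rep x ⁆ (rep x , x∈⁅x⁆ (rep x) , reverse (Adj-sym G) (proj₂ (walks x)))
    depth : Fin n → ℕ
    depth x = proj₁ (level x)
    proper : ∀ x y → Adj G x y →
      pair (parity (depth x) , side (rep x) (depth x) x) ≢ pair (parity (depth y) , side (rep y) (depth y) y)
    proper x y xy eq = clash (same x y xy) (proj₂ (proj₂ (level x))) (proj₂ (proj₂ (level y)))
      (trans (sym (unpair-pair _)) (trans (cong unpair eq) (unpair-pair _)))
      where
      clash : ∀ {r r′ i j} → r ≡ r′ → Level G ⁅ r ⁆ i x → Level G ⁅ r′ ⁆ j y →
        _≢_ {A = Bool × Bool} (parity i , side r i x) (parity j , side r′ j y)
      clash {r} refl p q eq = separated r xy p q (cong proj₁ eq) (cong proj₂ eq)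

  -- Deleting an edge on no shortest cycle

  module _ {u v : Fin n} (uv : Adj G u v) (offCycle : ¬ EdgeOnCycleOfLength G (2 * ℓ + 1) u v) where

    private
      G′ : Graph n
      G′ = deleteEdge G u v

      samePair? : ∀ x y → Dec (SamePair x y u v)
      samePair? x y = ((x ≟ u) ×-dec (y ≟ v)) ⊎-dec ((x ≟ v) ×-dec (y ≟ u))

      G′⇒G : ∀ x y → Adj G′ x y → Adj G x y
      G′⇒G x y a = proj₁ (deleteEdge⁻ G u v x y a)

      module _ (c : ℕ → Fin n) (a e f : ℕ) (C : Cyclic G′ (suc e + suc f) c)
               (ends : SamePair (c a) (c (a + suc e)) u v) where

        -- The arc from `a` to `a + suc e` closes with the deleted edge to an induced cycle of `G`.
        -- If odd, it has length `2 * ℓ + 1` and contains that edge, against `offCycle`.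
        piece : ¬ Odd (suc (suc e))
        piece odd = offCycle (subst (λ k → EdgeOnCycleOfLength G k u v) (proj₂ (inducedLength noHole induced) odd)
            (g ∘ toℕ , proj₁ induced , fromℕ (suc e) , fzero , inj₂ (cong suc (Fin.toℕ-fromℕ (suc e)) , refl) ,
              samePair-swap (subst (λ t → SamePair (g 0) (g t) u v) (sym (Fin.toℕ-fromℕ (suc e))) g-ends)))
          where
          g : ℕ → Fin n
          g s = c (a + s)
          open Cyclic (shift G′ C a)
          g-ends : SamePair (g 0) (g (suc e)) u v
          g-ends = subst (λ z → SamePair (c z) (g (suc e)) u v) (sym (ℕ.+-identityʳ a)) ends
          -- An arc with a single edge would make the deleted edge an edge of `G′`; `1≤f` says the
          -- same of the complementary arc.
          1≤e : 1 ≤ e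
          1≤e = ℕ.n≢0⇒n>0 λ { refl → proj₂ (deleteEdge⁻ G u v _ _ (step 0)) g-ends }
          1≤f : 1 ≤ f
          1≤f = ℕ.n≢0⇒n>0 λ { refl → proj₂ (deleteEdge⁻ G u v _ _ (step (suc e)))
                  (samePair-swap (subst (λ z → SamePair z (g (suc e)) u v)
                    (sym (trans (cong (λ z → g (suc z)) (ℕ.+-comm 1 e)) (periodic 0))) g-ends)) }
          room : ∀ s t → t < suc (suc e) → t < s + (suc e + suc f)
          room s t t< = ℕ.<-≤-trans t< (ℕ.≤-trans
            (subst (suc (suc e) ≤_) (sym (ℕ.+-suc (suc e) f)) (s≤s (ℕ.m≤m+n (suc e) f))) (ℕ.m≤n+m _ s))
          g-inj : ∀ s t → s < t → t < suc (suc e) → g s ≢ g t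
          g-inj s t s<t t< = inj s t s<t (room s t t<)
          close : ∀ s → suc s ≡ suc (suc e) → Adj G (g s) (g 0)
          close s refl = samePair-adj G (samePair-swap g-ends) uv
          chord : ∀ s t → s < t → t < suc (suc e) → Adj G (g s) (g t) → t ≡ suc s ⊎ (s ≡ 0 × suc t ≡ suc (suc e))
          chord s t s<t t< st with samePair? (g s) (g t)
          ... | no ¬same with chordless s t s<t (room s t t<) (deleteEdge⁺ G u v _ _ st ¬same)
          ...   | inj₁ eq = inj₁ eq
          ...   | inj₂ eq = ⊥-elim (ℕ.<⇒≱ (piece-arith e f t s (ℕ.≤-pred t<) 1≤f eq) z≤n)
          chord s t s<t t< st | yes same with samePair-compare same g-ends
          ...   | inj₂ (_ , t≡0) = ⊥-elim (g-inj 0 t (ℕ.≤-trans (s≤s z≤n) s<t) t< (sym t≡0))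
          ...   | inj₁ (s≡0 , t≡e) = inj₂ (first s (ℕ.<-trans s<t t<) s≡0 , cong suc (last t≡e))
            where
            first : ∀ s → s < suc (suc e) → g s ≡ g 0 → s ≡ 0
            first zero    _  _  = refl
            first (suc s) s< eq = ⊥-elim (g-inj 0 (suc s) (s≤s z≤n) s< (sym eq))
            last : g t ≡ g (suc e) → t ≡ suc e
            last eq with ℕ.m≤n⇒m<n∨m≡n (ℕ.≤-pred t<)
            ... | inj₁ t<e = ⊥-elim (g-inj t (suc e) t<e ℕ.≤-refl eq)
            ... | inj₂ t≡e′ = t≡e′
          induced : IsInducedCycle G (suc (suc e)) (g ∘ toℕ)
          induced = inducedCycle G g (cycle G g (s≤s (s≤s 1≤e)) (λ s _ → G′⇒G _ _ (step s)) close g-inj) chord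

      -- The deleted edge splits an odd hole through both of its ends into two induced cycles of G, one of them odd.
      noChord : ∀ (c : ℕ → Fin n) a e f → Cyclic G′ (suc e + suc f) c → Odd (suc e + suc f) →
        ¬ SamePair (c a) (c (a + suc e)) u v
      noChord c a e f C odd ends with odd-+ (suc (suc e)) (suc (suc f)) (subst Odd (pieces-sum e f) odd)
      ... | inj₁ o = piece c a e f C ends o
      ... | inj₂ o = piece c (a + suc e) f e (subst (λ k → Cyclic G′ k c) (ℕ.+-comm (suc e) (suc f)) C)
              (samePair-swap (subst (λ z → SamePair z (c (a + suc e)) u v)
                (sym (trans (cong c (ℕ.+-assoc a (suc e) (suc f))) (Cyclic.periodic C a))) ends)) o

      -- The positions `i` and `j` cut the hole into arcs of `suc e` and `suc f` edges, as `noChord`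
      -- requires.
      throughEnds : ∀ {k} (c : Fin k → Fin n) → IsInducedCycle G′ k c → Odd k →
        ∀ i j → toℕ i < toℕ j → ¬ SamePair (c i) (c j) u v
      throughEnds {suc k} c hole odd i j i<j same
        with <⇒∃+ i<j | <⇒∃+ (ℕ.<-≤-trans (Fin.toℕ<n j) (ℕ.m≤n+m (suc k) (toℕ i)))
      ... | e , j≡ | f , k≡ = noChord c̃ (toℕ i) e f (subst (λ z → Cyclic G′ z c̃) split (cyclic G′ hole)) (subst Odd split odd)
              (subst₂ (λ x y → SamePair x y u v) (at-toℕ i) (trans (at-toℕ j) (cong c̃ j≡)) same)
        where
        c̃ : ℕ → Fin n
        c̃ s = c (fromℕ< (m%n<n s (suc k)))
        at-toℕ : ∀ i → c i ≡ c̃ (toℕ i)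
        at-toℕ i = cong c (Fin.toℕ-injective (sym (trans (Fin.toℕ-fromℕ< (m%n<n (toℕ i) (suc k))) (m<n⇒m%n≡m (Fin.toℕ<n i)))))
        split : suc k ≡ suc e + suc f
        split = ℕ.+-cancelˡ-≡ (toℕ i) _ _ (trans k≡ (trans (cong (_+ suc f) j≡) (ℕ.+-assoc (toℕ i) (suc e) (suc f))))

    -- The hole does not contain both `u` and `v`, so it is still induced in `G`.
    deleteEdge-noHole : ∀ k (c : Fin k → Fin n) → 2 * ℓ + 3 ≤ k → ¬ IsOddHole G′ k c
    deleteEdge-noHole k c k≥ (((cyc@(3≤k , c-inj , step) , chord) , 4≤k) , odd)
      = noHole k c k≥ ((((3≤k , c-inj , λ i j ij → G′⇒G _ _ (step i j ij)) ,
          λ i j ij → chord i j (deleteEdge⁺ G u v _ _ ij (¬same i j))) , 4≤k) , odd)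
      where
      ¬same : ∀ i j → ¬ SamePair (c i) (c j) u v
      ¬same i j same with ℕ.<-cmp (toℕ i) (toℕ j)
      ... | tri< i<j _ _ = throughEnds c (cyc , chord) odd i j i<j same
      ... | tri> _ _ j<i = throughEnds c (cyc , chord) odd j i j<i (samePair-swap same)
      ... | tri≈ _ i≡j _ = Adj⇒≢ G (samePair-adj G same uv) (cong c (Fin.toℕ-injective i≡j))

    -- The given cycle of length `2 * ℓ + 1` survives because the deleted edge lies on none, and
    -- every cycle of `G′` is one of `G`.
    deleteEdge-In𝒢 : HasCycleOfLength G (2 * ℓ + 1) → In𝒢 ℓ G′
    deleteEdge-In𝒢 (c , cyc@(3≤k , c-inj , step)) =
      ((c , 3≤k , c-inj , λ i j ij → deleteEdge⁺ G u v _ _ (step i j ij) λ same → offCycle (c , cyc , i , j , ij , same)) ,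
       λ { k k< (d , 3≤k , d-inj , d-step) → girth k k< (d , 3≤k , d-inj , λ i j ij → G′⇒G _ _ (d-step i j ij)) }) ,
      deleteEdge-noHole

theorem1p2 : (ℓ : ℕ) → 2 ≤ ℓ → ∀ {n} (G : Graph n) → In𝒢 ℓ G →
    (S : Subset n) → InducedConnected G S →
    ((u v : Fin n) → Adj G u v → ¬ EdgeOnCycleOfLength G (2 * ℓ + 1) u v →
    In𝒢 ℓ (deleteEdge G u v))
    × (((i : ℕ) → 1 ≤ i → i ≤ ℓ / 2 → InducedBipartite G (Level G S i)) →
    (i : ℕ) → 0 < i → InducedBipartite G (Level G S i))
    × ChromaticAtMost G 4
theorem1p2 ℓ 2≤ℓ G ((shortest , girth) , noHole) S connected =
    (λ u v uv offCycle → deleteEdge-In𝒢 G ℓ 2≤ℓ girth noHole uv offCycle shortest)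
  , (λ { base (suc i) _ → bipartiteLevel G ℓ 2≤ℓ girth noHole S connected base i })
  , fourColourable G ℓ 2≤ℓ girth noHole
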